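{- Let $\beta(n)$ be the number of bubbles of length $n$, of arbitrary width $r\ge 2$ and arbitrary height. Then, as formal power series, $$\sum_{n\ge 0}\beta(n)q^n=\frac{1}{2q}\left(1-q-q^2-q^3-q^4-q^5-\sqrt{(1+q)(1+q+q^2)(1-q+q^2)(1-q-q^2)(1-2q-q^3)}\right),$$ where $\sqrt{\cdot}$ denotes the formal power series square root with constant term $1$.
   Context: Cells are unit squares of the square lattice, adjacent when they share an edge. A snake of length $n$ is an edge-connected set of $n$ cells (up to translation) whose adjacency graph has no cycle and all degrees at most two (so it is a path). It is a partially directed snake (PDS) if its cells can be listed $c_1,\dots,c_n$ from one end (tail) to the other (head) with every step North, East or West. A bubble of width $r\ge 2$ is a PDS whose tail $c_1$ and head $c_n$ lie in one and the same column, called column $1$, all of whose other cells lie in columns $2,\dots,r$ (columns numbered from left to right, so tail and head are on the left), and which has at least one cell in column $r$. -}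

module Defs where

open import Data.Fin.Base using (Fin; toℕ)
open import Data.Integer.Base as ℤ using (ℤ; +_; -[1+_])
import Data.Integer.Properties as ℤ
open import Data.List.Base using (List; []; _∷_; _∷ʳ_; filter; length; map)
open import Data.List.Membership.Propositional using (_∈_)
open import Data.List.Properties using (map-∘; map-cong; map-id)
open import Data.List.Relation.Binary.Permutation.Propositional using (_↭_; ↭-reflexive; ↭-sym; ↭-trans)
open import Data.List.Relation.Binary.Permutation.Propositional.Properties using (map⁺)
open import Data.List.Relation.Unary.All using (All)
open import Data.List.Relation.Unary.Any using (Any)
open import Data.List.Relation.Unary.Linked using (Linked)
open import Data.List.Relation.Unary.Unique.Propositional using (Unique)
open import Data.Nat.Base as ℕ using (ℕ; zero; suc; _≤_)
import Data.Nat.Properties as ℕ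
open import Data.Product.Base using (Σ; ∃; ∃-syntax; _×_; _,_; proj₁; proj₂)
open import Data.Rational.Base as ℚ using (ℚ; 0ℚ; 1ℚ)
import Data.Rational.Properties as ℚ
open import Algebra.Definitions.RawSemiring ℚ.+-*-rawSemiring using (sum)
open import Function.Base using (_∘_)
open import Function.Bundles using (Inverse)
open import Level using (0ℓ)
open import Relation.Binary.Bundles using (Setoid)
open import Relation.Binary.Construct.Closure.ReflexiveTransitive using (Star)
open import Relation.Binary.PropositionalEquality as ≡ using (_≡_; refl; cong; cong₂)
open import Relation.Nullary using (Dec; ¬_)

------------------------------------------------------------------------
-- Cells

-- (x , y) is the unit square in column x and row y.
Cell : Set
Cell = ℤ × ℤ

Adjacent : Cell → Cell → Set
Adjacent (x , y) (x′ , y′) = ℤ.∣ x ℤ.- x′ ∣ ℕ.+ ℤ.∣ y ℤ.- y′ ∣ ≡ 1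

adjacent? : ∀ c d → Dec (Adjacent c d)
adjacent? (x , y) (x′ , y′) = ℤ.∣ x ℤ.- x′ ∣ ℕ.+ ℤ.∣ y ℤ.- y′ ∣ ℕ.≟ 1

infixr 6 _⊞_
_⊞_ : Cell → Cell → Cell
(a , b) ⊞ (x , y) = a ℤ.+ x , b ℤ.+ y

------------------------------------------------------------------------
-- Snakes.  A finite set of cells is represented by a duplicate-free list
-- whose order is irrelevant: two such lists are the same set exactly when
-- they are permutations of one another.

AdjacentIn : List Cell → Cell → Cell → Set
AdjacentIn S c d = c ∈ S × d ∈ S × Adjacent c d

-- The closed walk c ∷ cs ∷ʳ c, with at least three distinct vertices.
record IsCycle (S : List Cell) (c : Cell) (cs : List Cell) : Set where
  field
    inside   : All (_∈ S) (c ∷ cs)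
    distinct : Unique (c ∷ cs)
    long     : 3 ≤ length (c ∷ cs)
    closed   : Linked Adjacent (c ∷ cs ∷ʳ c)

degree : List Cell → Cell → ℕ
degree S c = length (filter (adjacent? c) S)

record IsSnake (n : ℕ) (S : List Cell) : Set where
  field
    unique    : Unique S
    size      : length S ≡ n
    connected : ∀ {c d} → c ∈ S → d ∈ S → Star (AdjacentIn S) c d
    acyclic   : ∀ c cs → ¬ IsCycle S c cs
    degree≤2  : ∀ {c} → c ∈ S → degree S c ≤ 2

------------------------------------------------------------------------
-- Partially directed snakes

data Direction : Set where
  north east west : Direction

vector : Direction → Cell
vector north = + 0      , + 1
vector east  = + 1      , + 0
vector west  = -[1+ 0 ] , + 0

Step : Cell → Cell → Set
Step c d = ∃[ δ ] d ≡ vector δ ⊞ c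

-- cs lists the cells of S from tail to head.
record IsListing (S cs : List Cell) : Set where
  field
    listsS : cs ↭ S
    steps  : Linked Step cs

record IsPDS (n : ℕ) (S : List Cell) : Set where
  field
    snake   : IsSnake n S
    listing : ∃ (IsListing S)

------------------------------------------------------------------------
-- Bubbles

-- The number of the column of c when the column of t has number 1.
column : Cell → Cell → ℤ
column t c = proj₁ c ℤ.- proj₁ t ℤ.+ + 1

-- A listing whose tail and head lie in column 1 and whose other cells lie
-- in columns 2 to r has distinct tail and head: a single cell cannot also
-- meet column r ≥ 2.  So every such listing has the form below.
record IsBubbleOfWidth (r n : ℕ) (S : List Cell) : Set where
  field
    2≤r         : 2 ≤ r
    pds         : IsPDS n S
    tail        : Cell
    others      : List Cell
    head        : Cell
    listing     : IsListing S (tail ∷ others ∷ʳ head)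
    headColumn  : column tail head ≡ + 1
    otherColumn : All (λ c → + 2 ℤ.≤ column tail c × column tail c ℤ.≤ + r) others
    reachesr    : Any (λ c → column tail c ≡ + r) S

IsBubble : ℕ → List Cell → Set
IsBubble n S = ∃[ r ] IsBubbleOfWidth r n S

------------------------------------------------------------------------
-- Finite sets of cells up to translation

infix 4 _≈ᵗ_
_≈ᵗ_ : List Cell → List Cell → Set
S ≈ᵗ T = ∃[ v ] map (v ⊞_) S ↭ T

private
  ⊖_ : Cell → Cell
  ⊖ (a , b) = ℤ.- a , ℤ.- b

  ⊞-identityˡ : ∀ c → (+ 0 , + 0) ⊞ c ≡ c
  ⊞-identityˡ (x , y) = cong₂ _,_ (ℤ.+-identityˡ x) (ℤ.+-identityˡ y)

  ⊞-assoc : ∀ v w c → (v ⊞ w) ⊞ c ≡ v ⊞ (w ⊞ c)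
  ⊞-assoc (a , b) (a′ , b′) (x , y) = cong₂ _,_ (ℤ.+-assoc a a′ x) (ℤ.+-assoc b b′ y)

  ⊞-inverseˡ : ∀ v c → (⊖ v) ⊞ (v ⊞ c) ≡ c
  ⊞-inverseˡ v@(a , b) c = ≡.trans (≡.sym (⊞-assoc (⊖ v) v c))
    (≡.trans (cong (_⊞ c) (cong₂ _,_ (ℤ.+-inverseˡ a) (ℤ.+-inverseˡ b))) (⊞-identityˡ c))

  map-identity : ∀ (f : Cell → Cell) → (∀ c → f c ≡ c) → ∀ S → map f S ≡ S
  map-identity f f≗id S = ≡.trans (map-cong f≗id S) (map-id S)

≈ᵗ-refl : ∀ {S} → S ≈ᵗ S
≈ᵗ-refl {S} = (+ 0 , + 0) , ↭-reflexive (map-identity _ ⊞-identityˡ S)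

≈ᵗ-sym : ∀ {S T} → S ≈ᵗ T → T ≈ᵗ S
≈ᵗ-sym {S} (v , p) = ⊖ v , ↭-trans (map⁺ ((⊖ v) ⊞_) (↭-sym p))
  (↭-reflexive (≡.trans (≡.sym (map-∘ S)) (map-identity _ (⊞-inverseˡ v) S)))

≈ᵗ-trans : ∀ {S T U} → S ≈ᵗ T → T ≈ᵗ U → S ≈ᵗ U
≈ᵗ-trans {S} (v , p) (w , q) = w ⊞ v , ↭-trans
  (↭-reflexive (≡.trans (map-cong (⊞-assoc w v) S) (map-∘ S)))
  (↭-trans (map⁺ (w ⊞_) p) q)

Bubble : ℕ → Setoid 0ℓ 0ℓ
Bubble n = record
  { Carrier       = Σ (List Cell) (IsBubble n)
  ; _≈_           = λ B C → proj₁ B ≈ᵗ proj₁ C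
  ; isEquivalence = record
    { refl  = λ {B} → ≈ᵗ-refl {proj₁ B}
    ; sym   = λ {B} {C} → ≈ᵗ-sym {proj₁ B} {proj₁ C}
    ; trans = λ {B} {C} {D} → ≈ᵗ-trans {proj₁ B} {proj₁ C} {proj₁ D}
    }
  }

HasCardinality : Setoid 0ℓ 0ℓ → ℕ → Set
HasCardinality A k = Inverse A (≡.setoid (Fin k))

------------------------------------------------------------------------
-- Formal power series in q with rational coefficients

Series : Set
Series = ℕ → ℚ

infix 4 _≈_
_≈_ : Series → Series → Set
f ≈ g = ∀ n → f n ≡ g n

𝟏 : Series
𝟏 zero    = 1ℚ
𝟏 (suc _) = 0ℚ

q : Series
q (suc zero) = 1ℚ
q _          = 0ℚ

infixl 6 _+_ _-_
infixl 7 _*_ _·_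
infixr 8 _^_

_+_ : Series → Series → Series
(f + g) n = f n ℚ.+ g n

_-_ : Series → Series → Series
(f - g) n = f n ℚ.- g n

_*_ : Series → Series → Series
(f * g) n = sum {suc n} (λ i → f (toℕ i) ℚ.* g (n ℕ.∸ toℕ i))

_^_ : Series → ℕ → Series
f ^ zero  = 𝟏
f ^ suc k = f * f ^ k

fromℕ : ℕ → ℚ
fromℕ k = + k ℚ./ 1

_·_ : ℕ → Series → Series
(k · f) n = fromℕ k ℚ.* f n

-- Σₙ a(n) qⁿ
generatingFunction : (ℕ → ℕ) → Series
generatingFunction a = fromℕ ∘ a

-- s = √f.  There is at most one such s, as ℚ⟦q⟧ is an integral domain and
-- the only other root -s has constant term -1.
IsSqrt : Series → Series → Set
IsSqrt f s = s 0 ≡ 1ℚ × s * s ≈ f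

-- f = g / h.  For h ≢ 0 there is at most one such f, as ℚ⟦q⟧ is an
-- integral domain.
IsQuotient : Series → Series → Series → Set
IsQuotient g h f = h * f ≈ g

radicand : Series
radicand = (𝟏 + q) * (𝟏 + q + q ^ 2) * (𝟏 - q + q ^ 2) * (𝟏 - q - q ^ 2) * (𝟏 - 2 · q - q ^ 3)

{-# OPTIONS --safe #-}

-- A bubble is the word of its steps.  A word in N, E, W is a snake exactly when
-- it avoids EW, WE, ENW and WNE, and this is checked by a five-state automaton,
-- so bubbles are walks of the automaton that start with E in column 1 and stop
-- at the first return to that column.  Such a walk starting in any column to
-- the right splits at its first arrival in each column, always by a step W;
-- hence the counting series satisfy a finite system of quadratic equations.
-- Eliminating leaves q B² - P B + q⁵ = 0 for the series B of bubbles, where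
-- P = 1 - q - q² - q³ - q⁴ - q⁵, and the radicand is P² - 4 q⁶.

module Submission where

open import Algebra.Bundles using (CommutativeRing; module AbelianGroup; module Semiring)
import Algebra.Definitions.RawSemiring
import Algebra.Properties.CommutativeSemigroup
import Algebra.Properties.Group
import Algebra.Properties.Ring
import Algebra.Properties.Semiring.Mult.TCOptimised
import Algebra.Solver.Ring
open import Algebra.Solver.Ring.AlmostCommutativeRing
  using (fromCommutativeRing; _-Raw-AlmostCommutative⟶_)
open import Data.Empty using (⊥; ⊥-elim)
open import Data.Fin.Base using (Fin)
open import Data.Fin.Properties using (+↔⊎; 0↔⊥; 1↔⊤)
open import Data.Integer.Base as ℤ using (ℤ; +_; -[1+_]; _⊖_)
import Data.Integer.Properties as ℤ
open import Data.Integer.Solver using (module +-*-Solver)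
open import Data.List.Base using (List; []; _∷_; _∷ʳ_; _++_; [_]; filter; length; map)
import Data.List.Extrema
import Data.List.Membership.DecPropositional
open import Data.List.Membership.Propositional using (_∈_; lose)
open import Data.List.Membership.Propositional.Properties using (∈-∃++; ∈-++⁺ˡ)
open import Data.List.Properties using (++-assoc; filter-none; filter-reject)
open import Data.List.Relation.Binary.Permutation.Propositional
  using (_↭_; ↭⇒↭ₛ; ↭-refl; ↭-reflexive; ↭-sym; ↭-trans)
open import Data.List.Relation.Binary.Permutation.Propositional.Properties
  using (Any-resp-↭; drop-∷; map⁺; ↭-length; ∈-resp-↭)
import Data.List.Relation.Binary.Permutation.Setoid.Properties
open import Data.List.Relation.Unary.All as All using (All; []; _∷_)
import Data.List.Relation.Unary.All.Properties as All
open import Data.List.Relation.Unary.AllPairs using (AllPairs; []; _∷_)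
open import Data.List.Relation.Unary.Any using (here; there)
open import Data.List.Relation.Unary.Linked as Linked using (Linked; [-]; []; _∷_)
open import Data.List.Relation.Unary.Unique.Propositional using (Unique)
open import Data.Maybe.Base using (Maybe; just; nothing)
open import Data.Nat.Base as ℕ using (ℕ; suc; zero; _≤_; s≤s; z≤n)
import Data.Nat.Properties as ℕ
open import Data.Product.Base using (Σ; ∃-syntax; _×_; _,_; proj₁; proj₂)
open import Data.Product.Properties using (≡-dec)
open import Data.Rational.Base as ℚ using (ℚ; 0ℚ; 1ℚ)
import Data.Rational.Properties as ℚ
import Data.Rational.Unnormalised.Base as ℚᵘ
import Data.Rational.Unnormalised.Properties as ℚᵘ
open import Data.Sum.Base using (_⊎_; inj₁; inj₂)
open import Data.Sum.Function.Propositional using (_⊎-↔_)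
open import Data.Unit.Base using (⊤; tt)
open import Function.Base using (_∘_)
open import Function.Bundles using (Inverse; _↔_; mk↔ₛ′)
import Function.Construct.Composition as Composition
open import Function.Properties.Inverse using (↔-refl; ↔-sym; ↔-trans)
open import Level using (0ℓ)
open import Relation.Binary.Construct.Closure.ReflexiveTransitive as Star using (Star; ε; _◅_; _◅◅_)
open import Relation.Binary.Definitions using (WeaklyDecidable)
open import Relation.Binary.PropositionalEquality as ≡ using (_≡_; cong; cong₂; refl)
import Relation.Binary.Reasoning.Setoid
open import Relation.Nullary using (¬_; contradiction; no; yes)
open import Relation.Unary using (Decidable)

open import Defs

open Algebra.Properties.Group (AbelianGroup.group ℤ.+-0-abelianGroup) using (∙-cancelʳ)
open Data.List.Membership.DecPropositional {A = Cell} (≡-dec ℤ._≟_ ℤ._≟_) using (_∈?_)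
open Data.List.Relation.Binary.Permutation.Setoid.Properties (≡.setoid Cell) using (Unique-resp-↭)

-- Polynomial identities in commutative rings

module IntegerPolynomials {c ℓ} (R : CommutativeRing c ℓ) where

  open CommutativeRing R renaming (_+_ to _⊕_; _*_ to _⊛_; _-_ to _⊝_; _≈_ to _≋_; refl to ≋-refl)
  open Algebra.Properties.Ring ring using (-‿distribˡ-*; -‿distribʳ-*; -0#≈0#; -‿+-comm; -‿involutive)
  open Algebra.Properties.CommutativeSemigroup +-commutativeSemigroup using (interchange)
  open Algebra.Properties.Semiring.Mult.TCOptimised semiring using (×-homo-+; ×1-homo-*; 1+×) renaming (_×_ to _×ᴿ_)
  open Relation.Binary.Reasoning.Setoid setoid

  -- The optimised multiple _×ᴿ_ makes fromℤ (+ 1) definitionally equal to 1#.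
  fromℤ : ℤ → Carrier
  fromℤ (+ n)    = n ×ᴿ 1#
  fromℤ -[1+ n ] = - (suc n ×ᴿ 1#)

  fromℤ-⊖ : ∀ m n → fromℤ (m ⊖ n) ≋ (m ×ᴿ 1#) ⊝ (n ×ᴿ 1#)
  fromℤ-⊖ m       zero    = sym (trans (+-congˡ -0#≈0#) (+-identityʳ _))
  fromℤ-⊖ zero    (suc n) = sym (+-identityˡ _)
  fromℤ-⊖ (suc m) (suc n) = begin
    fromℤ (suc m ⊖ suc n)                         ≡⟨ cong fromℤ (ℤ.[1+m]⊖[1+n]≡m⊖n m n) ⟩
    fromℤ (m ⊖ n)                                 ≈⟨ fromℤ-⊖ m n ⟩
    (m ×ᴿ 1#) ⊝ (n ×ᴿ 1#)                         ≈⟨ +-identityˡ _ ⟨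
    0# ⊕ ((m ×ᴿ 1#) ⊝ (n ×ᴿ 1#))                  ≈⟨ +-congʳ (-‿inverseʳ 1#) ⟨
    (1# ⊝ 1#) ⊕ ((m ×ᴿ 1#) ⊝ (n ×ᴿ 1#))           ≈⟨ interchange _ _ _ _ ⟩
    (1# ⊕ (m ×ᴿ 1#)) ⊕ (- 1# ⊕ - (n ×ᴿ 1#))       ≈⟨ +-cong (sym (1+× m 1#)) (-‿+-comm _ _) ⟩
    (suc m ×ᴿ 1#) ⊝ (1# ⊕ (n ×ᴿ 1#))              ≈⟨ +-congˡ (-‿cong (1+× n 1#)) ⟨
    (suc m ×ᴿ 1#) ⊝ (suc n ×ᴿ 1#)                 ∎

  fromℤ-+ : ∀ i j → fromℤ (i ℤ.+ j) ≋ fromℤ i ⊕ fromℤ j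
  fromℤ-+ (+ m)    (+ n)    = ×-homo-+ 1# m n
  fromℤ-+ (+ m)    -[1+ n ] = fromℤ-⊖ m (suc n)
  fromℤ-+ -[1+ m ] (+ n)    = trans (fromℤ-⊖ n (suc m)) (+-comm _ _)
  fromℤ-+ -[1+ m ] -[1+ n ] = begin
    - (suc (suc (m ℕ.+ n)) ×ᴿ 1#)                 ≡⟨ cong (λ k → - (suc k ×ᴿ 1#)) (ℕ.+-suc m n) ⟨
    - ((suc m ℕ.+ suc n) ×ᴿ 1#)                   ≈⟨ -‿cong (×-homo-+ 1# (suc m) (suc n)) ⟩
    - ((suc m ×ᴿ 1#) ⊕ (suc n ×ᴿ 1#))             ≈⟨ -‿+-comm _ _ ⟨
    - (suc m ×ᴿ 1#) ⊕ - (suc n ×ᴿ 1#)             ∎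

  fromℤ-neg : ∀ i → fromℤ (ℤ.- i) ≋ - fromℤ i
  fromℤ-neg (+ zero)  = sym -0#≈0#
  fromℤ-neg (+ suc n) = ≋-refl
  fromℤ-neg -[1+ n ]  = sym (-‿involutive _)

  fromℤ-+* : ∀ m j → fromℤ (+ m ℤ.* j) ≋ fromℤ (+ m) ⊛ fromℤ j
  fromℤ-+* m (+ n) = begin
    fromℤ (+ m ℤ.* + n)                           ≡⟨ cong fromℤ (ℤ.pos-* m n) ⟨
    (m ℕ.* n) ×ᴿ 1#                               ≈⟨ ×1-homo-* m n ⟩
    (m ×ᴿ 1#) ⊛ (n ×ᴿ 1#)                         ∎
  fromℤ-+* m -[1+ n ] = begin
    fromℤ (+ m ℤ.* ℤ.- (+ suc n))                 ≡⟨ cong fromℤ (ℤ.neg-distribʳ-* (+ m) (+ suc n)) ⟨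
    fromℤ (ℤ.- (+ m ℤ.* + suc n))                 ≈⟨ fromℤ-neg (+ m ℤ.* + suc n) ⟩
    - fromℤ (+ m ℤ.* + suc n)                     ≈⟨ -‿cong (fromℤ-+* m (+ suc n)) ⟩
    - ((m ×ᴿ 1#) ⊛ (suc n ×ᴿ 1#))                 ≈⟨ -‿distribʳ-* _ _ ⟩
    (m ×ᴿ 1#) ⊛ - (suc n ×ᴿ 1#)                   ∎

  fromℤ-* : ∀ i j → fromℤ (i ℤ.* j) ≋ fromℤ i ⊛ fromℤ j
  fromℤ-* (+ m)    j = fromℤ-+* m j
  fromℤ-* -[1+ m ] j = begin
    fromℤ (ℤ.- (+ suc m) ℤ.* j)                   ≡⟨ cong fromℤ (ℤ.neg-distribˡ-* (+ suc m) j) ⟨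
    fromℤ (ℤ.- (+ suc m ℤ.* j))                   ≈⟨ fromℤ-neg (+ suc m ℤ.* j) ⟩
    - fromℤ (+ suc m ℤ.* j)                       ≈⟨ -‿cong (fromℤ-+* (suc m) j) ⟩
    - ((suc m ×ᴿ 1#) ⊛ fromℤ j)                   ≈⟨ -‿distribˡ-* _ _ ⟩
    - (suc m ×ᴿ 1#) ⊛ fromℤ j                     ∎

  private
    homomorphism : ℤ.+-*-rawRing -Raw-AlmostCommutative⟶ fromCommutativeRing R
    homomorphism = record
      { ⟦_⟧    = fromℤ
      ; +-homo = fromℤ-+
      ; *-homo = fromℤ-*
      ; -‿homo = fromℤ-neg
      ; 0-homo = ≋-refl
      ; 1-homo = ≋-refl
      }

    fromℤ-≟ : WeaklyDecidable (λ i j → fromℤ i ≋ fromℤ j)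
    fromℤ-≟ i j with i ℤ.≟ j
    ... | yes refl = just ≋-refl
    ... | no _     = nothing

  open Algebra.Solver.Ring ℤ.+-*-rawRing (fromCommutativeRing R) homomorphism fromℤ-≟ public
    using (Polynomial; solve; con; _:+_; _:*_; _:-_; _:=_)

module AlgebraicKernel {c ℓ} (R : CommutativeRing c ℓ) where

  open CommutativeRing R renaming (_+_ to _⊕_; _*_ to _⊛_; _-_ to _⊝_; _≈_ to _≋_; refl to ≋-refl)
  open IntegerPolynomials R
  open Relation.Binary.Reasoning.Setoid setoid
  open Algebra.Definitions.RawSemiring (Semiring.rawSemiring semiring) using () renaming (_^_ to _^ᴿ_)

  P : Carrier → Carrier
  P t = 1# ⊝ t ⊝ t ^ᴿ 2 ⊝ t ^ᴿ 3 ⊝ t ^ᴿ 4 ⊝ t ^ᴿ 5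

  private
    :1 : ∀ {n} → Polynomial n
    :1 = con (+ 1)

    infixr 9 _:^_
    _:^_ : ∀ {n} → Polynomial n → ℕ → Polynomial n
    p :^ zero  = :1
    p :^ suc k = p :* (p :^ k)

    :P : ∀ {n} → Polynomial n → Polynomial n
    :P t = :1 :- t :- t :^ 2 :- t :^ 3 :- t :^ 4 :- t :^ 5

  -- e, f, g, w, v count the walks that descend one column from the states
  -- E, EN, NN, W, WN, respectively.
  kernel : ∀ {t e f g w v} →
    e ≋ t ⊛ (f ⊕ e ⊛ w) →
    f ≋ t ⊛ (g ⊕ e ⊛ w) →
    g ≋ t ⊛ (g ⊕ e ⊛ w ⊕ 1#) →
    w ≋ t ⊛ (v ⊕ 1#) →
    v ≋ t ⊛ (g ⊕ 1#) →
    P t ⊛ e ≋ t ^ᴿ 3 ⊕ t ^ᴿ 3 ⊛ (e ⊛ e)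
  kernel {t} {e} {f} {g} {w} {v} e≋ f≋ g≋ w≋ v≋ = begin
    P t ⊛ e ≈⟨ solve 2 (λ t e → :P t :* e :=
        (e :+ t :+ t :^ 2) :- t :* (e :+ t :+ t :^ 2) :- t :+ t :^ 3 :-
          e :* (t :^ 2 :+ t :^ 3 :+ t :^ 4 :+ t :^ 5)) ≋-refl t e ⟩
    (e ⊕ t ⊕ t ^ᴿ 2) ⊝ t ⊛ (e ⊕ t ⊕ t ^ᴿ 2) ⊝ t ⊕ t ^ᴿ 3 ⊝ r
      ≈⟨ +-congʳ (+-congʳ (+-congʳ (+-cong (sym g≋e) (-‿cong (*-congˡ (sym g≋e)))))) ⟩
    g ⊝ t ⊛ g ⊝ t ⊕ t ^ᴿ 3 ⊝ r  ≈⟨ +-congʳ (+-congʳ (+-congʳ (+-congʳ g≋))) ⟩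
    t ⊛ (g ⊕ e ⊛ w ⊕ 1#) ⊝ t ⊛ g ⊝ t ⊕ t ^ᴿ 3 ⊝ r
      ≈⟨ solve 5 (λ t g e w r → t :* (g :+ e :* w :+ :1) :- t :* g :- t :+ t :^ 3 :- r :=
           t :* e :* w :+ t :^ 3 :- r) ≋-refl t g e w r ⟩
    t ⊛ e ⊛ w ⊕ t ^ᴿ 3 ⊝ r  ≈⟨ +-congʳ (+-congʳ (*-congˡ w≋e)) ⟩
    t ⊛ e ⊛ (t ⊛ (t ⊛ ((e ⊕ t ⊕ t ^ᴿ 2) ⊕ 1#) ⊕ 1#)) ⊕ t ^ᴿ 3 ⊝ r
      ≈⟨ solve 2 (λ t e → t :* e :* (t :* (t :* ((e :+ t :+ t :^ 2) :+ :1) :+ :1)) :+ t :^ 3 :-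
           e :* (t :^ 2 :+ t :^ 3 :+ t :^ 4 :+ t :^ 5) := t :^ 3 :+ t :^ 3 :* (e :* e)) ≋-refl t e ⟩
    t ^ᴿ 3 ⊕ t ^ᴿ 3 ⊛ (e ⊛ e) ∎
    where
    r : Carrier
    r = e ⊛ (t ^ᴿ 2 ⊕ t ^ᴿ 3 ⊕ t ^ᴿ 4 ⊕ t ^ᴿ 5)

    e≋g : e ≋ g ⊝ t ⊝ t ^ᴿ 2
    e≋g = begin
      e                                    ≈⟨ e≋ ⟩
      t ⊛ (f ⊕ e ⊛ w)                      ≈⟨ *-congˡ (+-congʳ f≋) ⟩
      t ⊛ (t ⊛ (g ⊕ e ⊛ w) ⊕ e ⊛ w)
        ≈⟨ solve 4 (λ t g e w → t :* (t :* (g :+ e :* w) :+ e :* w) :=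
             (:1 :+ t) :* (t :* (g :+ e :* w :+ :1) :- t :* g :- t) :+ t :* t :* g) ≋-refl t g e w ⟩
      (1# ⊕ t) ⊛ (t ⊛ (g ⊕ e ⊛ w ⊕ 1#) ⊝ t ⊛ g ⊝ t) ⊕ t ⊛ t ⊛ g
        ≈⟨ +-congʳ (*-congˡ (+-congʳ (+-congʳ g≋))) ⟨
      (1# ⊕ t) ⊛ (g ⊝ t ⊛ g ⊝ t) ⊕ t ⊛ t ⊛ g
        ≈⟨ solve 2 (λ t g → (:1 :+ t) :* (g :- t :* g :- t) :+ t :* t :* g := g :- t :- t :^ 2) ≋-refl t g ⟩
      g ⊝ t ⊝ t ^ᴿ 2                        ∎

    g≋e : g ≋ e ⊕ t ⊕ t ^ᴿ 2
    g≋e = begin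
      g                             ≈⟨ solve 2 (λ t g → g := (g :- t :- t :^ 2) :+ t :+ t :^ 2) ≋-refl t g ⟩
      (g ⊝ t ⊝ t ^ᴿ 2) ⊕ t ⊕ t ^ᴿ 2   ≈⟨ +-congʳ (+-congʳ e≋g) ⟨
      e ⊕ t ⊕ t ^ᴿ 2                 ∎

    w≋e : w ≋ t ⊛ (t ⊛ ((e ⊕ t ⊕ t ^ᴿ 2) ⊕ 1#) ⊕ 1#)
    w≋e = trans w≋ (*-congˡ (+-congʳ (trans v≋ (*-congˡ (+-congʳ g≋e)))))

  discriminant : ∀ {t d e} → d ≋ t ⊕ t → P t ⊛ e ≋ t ^ᴿ 3 ⊕ t ^ᴿ 3 ⊛ (e ⊛ e) →
    let s = P t ⊝ d ⊛ (t ⊛ (t ⊛ e)) in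
    s ⊛ s ≋ (1# ⊕ t) ⊛ (1# ⊕ t ⊕ t ^ᴿ 2) ⊛ (1# ⊝ t ⊕ t ^ᴿ 2) ⊛ (1# ⊝ t ⊝ t ^ᴿ 2) ⊛ (1# ⊝ d ⊝ t ^ᴿ 3)
  discriminant {t} {d} {e} d≋ Pe≋ = begin
    (P t ⊝ d ⊛ b) ⊛ (P t ⊝ d ⊛ b)
      ≈⟨ *-cong (+-congˡ (-‿cong (*-congʳ d≋))) (+-congˡ (-‿cong (*-congʳ d≋))) ⟩
    (P t ⊝ (t ⊕ t) ⊛ b) ⊛ (P t ⊝ (t ⊕ t) ⊛ b)
      ≈⟨ solve 3 (λ t e p → (p :- (t :+ t) :* (t :* (t :* e))) :* (p :- (t :+ t) :* (t :* (t :* e))) :=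
           p :* p :- con (+ 4) :* t :^ 3 :* (p :* e :- t :^ 3 :* (e :* e))) ≋-refl t e (P t) ⟩
    P t ⊛ P t ⊝ 4# ⊛ t ^ᴿ 3 ⊛ (P t ⊛ e ⊝ t ^ᴿ 3 ⊛ (e ⊛ e))
      ≈⟨ +-congˡ (-‿cong (*-congˡ (+-congʳ Pe≋))) ⟩
    P t ⊛ P t ⊝ 4# ⊛ t ^ᴿ 3 ⊛ (t ^ᴿ 3 ⊕ t ^ᴿ 3 ⊛ (e ⊛ e) ⊝ t ^ᴿ 3 ⊛ (e ⊛ e))
      ≈⟨ solve 2 (λ t e → :P t :* :P t :- con (+ 4) :* t :^ 3 :* (t :^ 3 :+ t :^ 3 :* (e :* e) :- t :^ 3 :* (e :* e)) :=
           (:1 :+ t) :* (:1 :+ t :+ t :^ 2) :* (:1 :- t :+ t :^ 2) :* (:1 :- t :- t :^ 2) :*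
             (:1 :- (t :+ t) :- t :^ 3)) ≋-refl t e ⟩
    (1# ⊕ t) ⊛ (1# ⊕ t ⊕ t ^ᴿ 2) ⊛ (1# ⊝ t ⊕ t ^ᴿ 2) ⊛ (1# ⊝ t ⊝ t ^ᴿ 2) ⊛ (1# ⊝ (t ⊕ t) ⊝ t ^ᴿ 3)
      ≈⟨ *-congˡ (+-congʳ (+-congˡ (-‿cong d≋))) ⟨
    (1# ⊕ t) ⊛ (1# ⊕ t ⊕ t ^ᴿ 2) ⊛ (1# ⊝ t ⊕ t ^ᴿ 2) ⊛ (1# ⊝ t ⊝ t ^ᴿ 2) ⊛ (1# ⊝ d ⊝ t ^ᴿ 3) ∎
    where
    b 4# : Carrier
    b  = t ⊛ (t ⊛ e)
    4# = fromℤ (+ 4)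

-- Formal power series

open ≡ using (_≢_; sym; trans; subst; module ≡-Reasoning)
open ≡-Reasoning
open Algebra.Properties.CommutativeSemigroup
  (CommutativeRing.+-commutativeSemigroup ℚ.+-*-commutativeRing) using (interchange; x∙yz≈y∙xz)

tailˢ : Series → Series
tailˢ f n = f (suc n)

-- By definition of sum, tailˢ (f * g) is f 0 times tailˢ g plus tailˢ f * g.
*-cong : ∀ {f f′ g g′} → f ≈ f′ → g ≈ g′ → f * g ≈ f′ * g′
*-cong f≈ g≈ zero    = cong₂ (λ x y → x ℚ.* y ℚ.+ 0ℚ) (f≈ 0) (g≈ 0)
*-cong f≈ g≈ (suc n) = cong₂ ℚ._+_ (cong₂ ℚ._*_ (f≈ 0) (g≈ (suc n))) (*-cong (f≈ ∘ suc) g≈ n)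

𝟎 : Series
𝟎 _ = 0ℚ

-_ : Series → Series
(- f) n = ℚ.- f n

*-zeroˡ : ∀ f → 𝟎 * f ≈ 𝟎
*-zeroˡ f zero    = trans (ℚ.+-identityʳ _) (ℚ.*-zeroˡ (f 0))
*-zeroˡ f (suc n) = cong₂ ℚ._+_ (ℚ.*-zeroˡ (f (suc n))) (*-zeroˡ f n)

*-identityˡ : ∀ f → 𝟏 * f ≈ f
*-identityˡ f zero    = trans (ℚ.+-identityʳ _) (ℚ.*-identityˡ (f 0))
*-identityˡ f (suc n) = trans (cong₂ ℚ._+_ (ℚ.*-identityˡ (f (suc n))) (*-zeroˡ f n)) (ℚ.+-identityʳ _)

*-distribʳ-+ : ∀ h f g → (f + g) * h ≈ f * h + g * h
*-distribʳ-+ h f g zero = begin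
  (f 0 ℚ.+ g 0) ℚ.* h 0 ℚ.+ 0ℚ                     ≡⟨ cong (ℚ._+ 0ℚ) (ℚ.*-distribʳ-+ (h 0) (f 0) (g 0)) ⟩
  (f 0 ℚ.* h 0 ℚ.+ g 0 ℚ.* h 0) ℚ.+ (0ℚ ℚ.+ 0ℚ)    ≡⟨ interchange (f 0 ℚ.* h 0) _ 0ℚ 0ℚ ⟩
  (f * h + g * h) 0                                ∎
*-distribʳ-+ h f g (suc n) =
  trans (cong₂ ℚ._+_ (ℚ.*-distribʳ-+ (h (suc n)) (f 0) (g 0)) (*-distribʳ-+ h (tailˢ f) (tailˢ g) n))
          (interchange (f 0 ℚ.* h (suc n)) _ ((tailˢ f * h) n) _)

*-scaleˡ : ∀ c f g → (λ k → c ℚ.* f k) * g ≈ (λ k → c ℚ.* (f * g) k)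
*-scaleˡ c f g zero = begin
  c ℚ.* f 0 ℚ.* g 0 ℚ.+ 0ℚ      ≡⟨ ℚ.+-identityʳ _ ⟩
  c ℚ.* f 0 ℚ.* g 0             ≡⟨ ℚ.*-assoc c (f 0) (g 0) ⟩
  c ℚ.* (f 0 ℚ.* g 0)           ≡⟨ cong (c ℚ.*_) (ℚ.+-identityʳ (f 0 ℚ.* g 0)) ⟨
  c ℚ.* (f * g) 0               ∎
*-scaleˡ c f g (suc n) =
  trans (cong₂ ℚ._+_ (ℚ.*-assoc c (f 0) (g (suc n))) (*-scaleˡ c (tailˢ f) g n))
          (sym (ℚ.*-distribˡ-+ c (f 0 ℚ.* g (suc n)) ((tailˢ f * g) n)))

*-assoc : ∀ f g h → (f * g) * h ≈ f * (g * h)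
*-assoc f g h zero    = begin
  (f 0 ℚ.* g 0 ℚ.+ 0ℚ) ℚ.* h 0 ℚ.+ 0ℚ   ≡⟨ cong (λ x → x ℚ.* h 0 ℚ.+ 0ℚ) (ℚ.+-identityʳ (f 0 ℚ.* g 0)) ⟩
  f 0 ℚ.* g 0 ℚ.* h 0 ℚ.+ 0ℚ            ≡⟨ cong (ℚ._+ 0ℚ) (ℚ.*-assoc (f 0) (g 0) (h 0)) ⟩
  f 0 ℚ.* (g 0 ℚ.* h 0) ℚ.+ 0ℚ          ≡⟨ cong (λ x → f 0 ℚ.* x ℚ.+ 0ℚ) (ℚ.+-identityʳ (g 0 ℚ.* h 0)) ⟨
  (f * (g * h)) 0                       ∎
*-assoc f g h (suc n) = begin
  (f 0 ℚ.* g 0 ℚ.+ 0ℚ) ℚ.* h (suc n) ℚ.+ (tailˢ (f * g) * h) n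
    ≡⟨ cong₂ ℚ._+_ (trans (cong (ℚ._* h (suc n)) (ℚ.+-identityʳ (f 0 ℚ.* g 0))) (ℚ.*-assoc (f 0) (g 0) (h (suc n))))
         (*-distribʳ-+ h (λ k → f 0 ℚ.* g (suc k)) (tailˢ f * g) n) ⟩
  a ℚ.+ (((λ k → f 0 ℚ.* g (suc k)) * h) n ℚ.+ ((tailˢ f * g) * h) n)
    ≡⟨ cong (a ℚ.+_) (cong₂ ℚ._+_ (*-scaleˡ (f 0) (tailˢ g) h n) (*-assoc (tailˢ f) g h n)) ⟩
  a ℚ.+ (f 0 ℚ.* (tailˢ g * h) n ℚ.+ (tailˢ f * (g * h)) n)
    ≡⟨ ℚ.+-assoc a _ _ ⟨
  a ℚ.+ f 0 ℚ.* (tailˢ g * h) n ℚ.+ (tailˢ f * (g * h)) n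
    ≡⟨ cong (ℚ._+ (tailˢ f * (g * h)) n) (ℚ.*-distribˡ-+ (f 0) (g 0 ℚ.* h (suc n)) ((tailˢ g * h) n)) ⟨
  (f * (g * h)) (suc n) ∎
  where
  a : ℚ
  a = f 0 ℚ.* (g 0 ℚ.* h (suc n))

*-sucʳ : ∀ f g n → (f * g) (suc n) ≡ f (suc n) ℚ.* g 0 ℚ.+ (f * tailˢ g) n
*-sucʳ f g zero    = x∙yz≈y∙xz (f 0 ℚ.* g 1) (f 1 ℚ.* g 0) 0ℚ
*-sucʳ f g (suc n) = trans (cong (f 0 ℚ.* g (suc (suc n)) ℚ.+_) (*-sucʳ (tailˢ f) g n))
  (x∙yz≈y∙xz (f 0 ℚ.* g (suc (suc n))) (f (suc (suc n)) ℚ.* g 0) ((tailˢ f * tailˢ g) n))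

*-comm : ∀ f g → f * g ≈ g * f
*-comm f g zero    = cong (ℚ._+ 0ℚ) (ℚ.*-comm (f 0) (g 0))
*-comm f g (suc n) = begin
  f 0 ℚ.* g (suc n) ℚ.+ (tailˢ f * g) n    ≡⟨ cong₂ ℚ._+_ (ℚ.*-comm (f 0) (g (suc n))) (*-comm (tailˢ f) g n) ⟩
  g (suc n) ℚ.* f 0 ℚ.+ (g * tailˢ f) n    ≡⟨ *-sucʳ g f n ⟨
  (g * f) (suc n)                         ∎

seriesRing : CommutativeRing 0ℓ 0ℓ
seriesRing = record
  { Carrier = Series ; _≈_ = _≈_ ; _+_ = _+_ ; _*_ = _*_ ; -_ = -_ ; 0# = 𝟎 ; 1# = 𝟏
  ; isCommutativeRing = record
    { isRing = record
      { +-isAbelianGroup = record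
        { isGroup = record
          { isMonoid = record
            { isSemigroup = record
              { isMagma = record
                { isEquivalence = record
                  { refl  = λ _ → refl
                  ; sym   = λ f≈g n → sym (f≈g n)
                  ; trans = λ f≈g g≈h n → trans (f≈g n) (g≈h n)
                  }
                ; ∙-cong = λ f≈ g≈ n → cong₂ ℚ._+_ (f≈ n) (g≈ n)
                }
              ; assoc = λ f g h n → ℚ.+-assoc (f n) (g n) (h n)
              }
            ; identity = (λ f n → ℚ.+-identityˡ (f n)) , (λ f n → ℚ.+-identityʳ (f n))
            }
          ; inverse = (λ f n → ℚ.+-inverseˡ (f n)) , (λ f n → ℚ.+-inverseʳ (f n))
          ; ⁻¹-cong = λ f≈ n → cong ℚ.-_ (f≈ n)
          }
        ; comm = λ f g n → ℚ.+-comm (f n) (g n)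
        }
      ; *-cong = *-cong
      ; *-assoc = *-assoc
      ; *-identity = *-identityˡ , λ f n → trans (*-comm f 𝟏 n) (*-identityˡ f n)
      ; distrib = (λ h f g n → trans (*-comm h (f + g) n) (trans (*-distribʳ-+ h f g n)
                    (cong₂ ℚ._+_ (*-comm f h n) (*-comm g h n))))
                , *-distribʳ-+
      }
    ; *-comm = *-comm
    }
  }

q*-suc : ∀ f n → (q * f) (suc n) ≡ f n
q*-suc f n = begin
  0ℚ ℚ.* f (suc n) ℚ.+ (tailˢ q * f) n    ≡⟨ cong₂ ℚ._+_ (ℚ.*-zeroˡ (f (suc n))) (*-cong {g = f} tailˢ-q (λ _ → refl) n) ⟩
  0ℚ ℚ.+ (𝟏 * f) n                       ≡⟨ ℚ.+-identityˡ _ ⟩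
  (𝟏 * f) n                              ≡⟨ *-identityˡ f n ⟩
  f n                                    ∎
  where
  tailˢ-q : tailˢ q ≈ 𝟏
  tailˢ-q zero    = refl
  tailˢ-q (suc _) = refl

≈q* : ∀ {f g} → f 0 ≡ 0ℚ → (∀ n → f (suc n) ≡ g n) → f ≈ q * g
≈q* {g = g} f₀ f₊ zero    = trans f₀ (sym (trans (ℚ.+-identityʳ _) (ℚ.*-zeroˡ (g 0))))
≈q* {g = g} f₀ f₊ (suc n) = trans (f₊ n) (sym (q*-suc g n))

fromℕ-+ : ∀ m n → fromℕ (m ℕ.+ n) ≡ fromℕ m ℚ.+ fromℕ n
fromℕ-+ m n = ℚ.toℚᵘ-injective (begin′
  ℚ.toℚᵘ (fromℕ (m ℕ.+ n))                    ≈⟨ ℚ.toℚᵘ-fromℚᵘ (ι (m ℕ.+ n)) ⟩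
  ι (m ℕ.+ n)                                 ≈⟨ ℚᵘ.*≡* (cong (ℤ._* + 1) (sym (cong₂ ℤ._+_ (ℤ.*-identityʳ (+ m)) (ℤ.*-identityʳ (+ n))))) ⟩
  ι m ℚᵘ.+ ι n                                ≈⟨ ℚᵘ.+-cong (ℚ.toℚᵘ-fromℚᵘ (ι m)) (ℚ.toℚᵘ-fromℚᵘ (ι n)) ⟨
  ℚ.toℚᵘ (fromℕ m) ℚᵘ.+ ℚ.toℚᵘ (fromℕ n)      ≈⟨ ℚ.toℚᵘ-homo-+ (fromℕ m) (fromℕ n) ⟨
  ℚ.toℚᵘ (fromℕ m ℚ.+ fromℕ n)                ∎′)
  where
  open Relation.Binary.Reasoning.Setoid ℚᵘ.≃-setoid renaming (begin_ to begin′_; _∎ to _∎′)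
  ι : ℕ → ℚᵘ.ℚᵘ
  ι k = ℚᵘ.mkℚᵘ (+ k) 0

2·≈ : ∀ f → 2 · f ≈ f + f
2·≈ f n = trans (ℚ.*-distribʳ-+ (f n) 1ℚ 1ℚ) (cong₂ ℚ._+_ (ℚ.*-identityˡ (f n)) (ℚ.*-identityˡ (f n)))

-- Counting walks

-- The state of a walk records how its next step is constrained: no step
-- west after east (E) or after east, north (EN), and symmetrically.
data State : Set where
  E EN NN WN W : State

next : State → Direction → Maybe State
next E  north = just EN
next E  east  = just E
next E  west  = nothing
next EN north = just NN
next EN east  = just E
next EN west  = nothing
next NN north = just NN
next NN east  = just E
next NN west  = just W
next WN north = just NN
next WN east  = nothing
next WN west  = just W
next W  north = just WN
next W  east  = nothing
next W  west  = just W

-- The height (distance to column 1) after a step from height suc h.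
move : Direction → ℕ → ℕ
move north h = suc h
move east  h = suc (suc h)
move west  h = h

count : State → ℕ → ℕ → ℕ
countVia : Maybe State → ℕ → ℕ → ℕ

count s zero    zero    = 1
count s zero    (suc n) = 0
count s (suc h) zero    = 0
count s (suc h) (suc n) =
  countVia (next s north) (move north h) n ℕ.+
  countVia (next s east) (move east h) n ℕ.+
  countVia (next s west) (move west h) n

countVia nothing  h n = 0
countVia (just s) h n = count s h n

countSeries : State → ℕ → Series
countSeries s h = generatingFunction (count s h)

viaSeries : Maybe State → ℕ → Series
viaSeries m h = generatingFunction (countVia m h)

countSeries-suc : ∀ s h n → countSeries s (suc h) (suc n) ≡
  (viaSeries (next s north) (move north h) + viaSeries (next s east) (move east h) + viaSeries (next s west) (move west h)) n
countSeries-suc s h n =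
  trans (fromℕ-+ (countVia (next s north) (move north h) n ℕ.+ countVia (next s east) (move east h) n) _)
          (cong (ℚ._+ viaSeries (next s west) h n) (fromℕ-+ (countVia (next s north) (move north h) n) _))

countSeries-zero : ∀ s → countSeries s 0 ≈ 𝟏
countSeries-zero s zero    = refl
countSeries-zero s (suc n) = refl

countSeries-0* : ∀ s f → f ≈ countSeries s 0 * f
countSeries-0* s f n = sym (trans (*-cong {g = f} (countSeries-zero s) (λ _ → refl) n) (*-identityˡ f n))

-- A walk descending from height suc h + k to 0 splits where it first reaches
-- height k, which it does by a step west.
countSeries-split : ∀ s h k → countSeries s (suc h ℕ.+ k) ≈ countSeries s (suc h) * countSeries W k
viaSeries-split   : ∀ m h k → viaSeries m (suc h ℕ.+ k) ≈ viaSeries m (suc h) * countSeries W k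
viaSeries-west    : ∀ s h k → viaSeries (next s west) (h ℕ.+ k) ≈ viaSeries (next s west) h * countSeries W k

countSeries-split s h k zero    = sym (trans (ℚ.+-identityʳ _) (ℚ.*-zeroˡ (countSeries W k 0)))
countSeries-split s h k (suc n) = begin
  countSeries s (suc h ℕ.+ k) (suc n)
    ≡⟨ countSeries-suc s (h ℕ.+ k) n ⟩
  (north′ (suc h ℕ.+ k) + east′ (suc (suc h) ℕ.+ k) + west′ (h ℕ.+ k)) n
    ≡⟨ cong₂ ℚ._+_ (cong₂ ℚ._+_ (viaSeries-split (next s north) h k n) (viaSeries-split (next s east) (suc h) k n))
         (viaSeries-west s h k n) ⟩
  (north′ (suc h) * c + east′ (suc (suc h)) * c + west′ h * c) n
    ≡⟨ cong (ℚ._+ (west′ h * c) n) (*-distribʳ-+ c (north′ (suc h)) (east′ (suc (suc h))) n) ⟨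
  ((north′ (suc h) + east′ (suc (suc h))) * c + west′ h * c) n
    ≡⟨ *-distribʳ-+ c (north′ (suc h) + east′ (suc (suc h))) (west′ h) n ⟨
  ((north′ (suc h) + east′ (suc (suc h)) + west′ h) * c) n
    ≡⟨ *-cong {g = c} (countSeries-suc s h) (λ _ → refl) n ⟨
  (tailˢ (countSeries s (suc h)) * c) n
    ≡⟨ trans (cong (ℚ._+ (tailˢ (countSeries s (suc h)) * c) n) (ℚ.*-zeroˡ (c (suc n)))) (ℚ.+-identityˡ _) ⟨
  (countSeries s (suc h) * c) (suc n) ∎
  where
  c : Series
  c = countSeries W k
  north′ east′ west′ : ℕ → Series
  north′ = viaSeries (next s north)
  east′  = viaSeries (next s east)
  west′  = viaSeries (next s west)

viaSeries-split nothing  h k n = sym (*-zeroˡ (countSeries W k) n)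
viaSeries-split (just s) h k n = countSeries-split s h k n

viaSeries-west s  (suc h) k n = viaSeries-split (next s west) h k n
viaSeries-west E  zero    k n = sym (*-zeroˡ (countSeries W k) n)
viaSeries-west EN zero    k n = sym (*-zeroˡ (countSeries W k) n)
viaSeries-west NN zero    k n = countSeries-0* W (countSeries W k) n
viaSeries-west WN zero    k n = countSeries-0* W (countSeries W k) n
viaSeries-west W  zero    k n = countSeries-0* W (countSeries W k) n

private
  module 𝕊 = CommutativeRing seriesRing

countSeries≈q* : ∀ s h → countSeries s (suc h) ≈
  q * (viaSeries (next s north) (suc h) + viaSeries (next s east) (suc (suc h)) + viaSeries (next s west) h)
countSeries≈q* s h = ≈q* refl (countSeries-suc s h)

eastSeries : Series
eastSeries = countSeries E 1

kernelEquation : (𝟏 - q - q ^ 2 - q ^ 3 - q ^ 4 - q ^ 5) * eastSeries ≈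
  q ^ 3 + q ^ 3 * (eastSeries * eastSeries)
kernelEquation = AlgebraicKernel.kernel seriesRing
  {q} {eastSeries} {countSeries EN 1} {countSeries NN 1} {countSeries W 1} {countSeries WN 1}
  (firstStep E λ n → trans (ℚ.+-identityʳ _) (cong (countSeries EN 1 n ℚ.+_) (countSeries-split E 0 1 n)))
  (firstStep EN λ n → trans (ℚ.+-identityʳ _) (cong (countSeries NN 1 n ℚ.+_) (countSeries-split E 0 1 n)))
  (firstStep NN λ n →
    cong₂ ℚ._+_ (cong (countSeries NN 1 n ℚ.+_) (countSeries-split E 0 1 n)) (countSeries-zero W n))
  (firstStep W λ n → cong₂ ℚ._+_ (ℚ.+-identityʳ (countSeries WN 1 n)) (countSeries-zero W n))
  (firstStep WN λ n → cong₂ ℚ._+_ (ℚ.+-identityʳ (countSeries NN 1 n)) (countSeries-zero W n))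
  where
  firstStep : ∀ s {f} →
    viaSeries (next s north) 1 + viaSeries (next s east) 2 + viaSeries (next s west) 0 ≈ f →
    countSeries s 1 ≈ q * f
  firstStep s f≈ = 𝕊.trans (countSeries≈q* s 0) (*-cong {q} (λ _ → refl) f≈)

-- A bubble of suc (suc n) cells has suc n steps, the first of them east.
β : ℕ → ℕ
β (suc (suc n)) = count E 1 n
β _             = 0

β-series : generatingFunction β ≈ q * (q * eastSeries)
β-series = ≈q* refl λ n → ≈q* {generatingFunction β ∘ suc} {eastSeries} refl (λ _ → refl) n

√radicandSeries : Series
√radicandSeries = 𝟏 - q - q ^ 2 - q ^ 3 - q ^ 4 - q ^ 5 - 2 · q * (q * (q * eastSeries))

√radicandSeries-sqrt : IsSqrt radicand √radicandSeries
√radicandSeries-sqrt = refl , AlgebraicKernel.discriminant seriesRing {q} {2 · q} {eastSeries} (2·≈ q) kernelEquation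

√radicandSeries-quotient : IsQuotient (𝟏 - q - q ^ 2 - q ^ 3 - q ^ 4 - q ^ 5 - √radicandSeries) (2 · q) (generatingFunction β)
√radicandSeries-quotient = 𝕊.trans (*-cong {2 · q} (λ _ → refl) β-series)
  (solve 2 (λ p x → x := p :- (p :- x)) (λ _ → refl) (𝟏 - q - q ^ 2 - q ^ 3 - q ^ 4 - q ^ 5) (2 · q * (q * (q * eastSeries))))
  where open IntegerPolynomials seriesRing

-- Induced paths

distance : Cell → Cell → ℕ
distance (x , y) (x′ , y′) = ℤ.∣ x ℤ.- x′ ∣ ℕ.+ ℤ.∣ y ℤ.- y′ ∣

distance-refl : ∀ c → distance c c ≡ 0
distance-refl (x , y) = cong₂ (λ i j → ℤ.∣ i ∣ ℕ.+ ℤ.∣ j ∣) (ℤ.i≡j⇒i-j≡0 {x} refl) (ℤ.i≡j⇒i-j≡0 {y} refl)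

adjacent-sym : ∀ {c d} → Adjacent c d → Adjacent d c
adjacent-sym {x , y} {x′ , y′} = trans (cong₂ ℕ._+_ (ℤ.∣i-j∣≡∣j-i∣ x′ x) (ℤ.∣i-j∣≡∣j-i∣ y′ y))

adjacent-irrefl : ∀ {c} → ¬ Adjacent c c
adjacent-irrefl {c} c~c with () ← trans (sym (distance-refl c)) c~c

data Induced : List Cell → Set where
  [-]  : ∀ {c} → Induced (c ∷ [])
  cons : ∀ {c d l} → Adjacent c d → All (c ≢_) (d ∷ l) → (∀ {e} → e ∈ d ∷ l → Adjacent c e → e ≡ d) →
         Induced (d ∷ l) → Induced (c ∷ d ∷ l)

induced-unique : ∀ {l} → Induced l → Unique l
induced-unique [-]            = [] ∷ []
induced-unique (cons _ c∉ _ i) = c∉ ∷ induced-unique i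

module _ {A : Set} {P : A → Set} (P? : Decidable P) where

  filter-≤1 : ∀ {x xs} → Unique xs → (∀ {y} → y ∈ xs → P y → y ≡ x) → length (filter P? xs) ≤ 1
  filter-≤1 []         _    = z≤n
  filter-≤1 {xs = y ∷ ys} (y∉ ∷ u) only with P? y
  ... | no _   = filter-≤1 u (only ∘ there)
  ... | yes Py = s≤s (ℕ.≤-reflexive (cong length (filter-none P? (All.tabulate λ z∈ Pz →
      All.lookup y∉ z∈ (trans (only (here refl) Py) (sym (only (there z∈) Pz)))))))

  filter-∷-≤ : ∀ x xs → length (filter P? (x ∷ xs)) ≤ suc (length (filter P? xs))
  filter-∷-≤ x xs with P? x
  ... | no _  = ℕ.n≤1+n _
  ... | yes _ = ℕ.≤-refl

degree-first≤1 : ∀ {c l} → Induced (c ∷ l) → degree (c ∷ l) c ≤ 1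
degree-first≤1 {c} [-] = ℕ.≤-trans (ℕ.≤-reflexive (cong length (filter-reject (adjacent? c) (adjacent-irrefl {c})))) z≤n
degree-first≤1 {c} (cons _ _ only i) = ℕ.≤-trans
  (ℕ.≤-reflexive (cong length (filter-reject (adjacent? c) (adjacent-irrefl {c}))))
  (filter-≤1 (adjacent? c) (induced-unique i) only)

induced-degree≤2 : ∀ {l c} → Induced l → c ∈ l → degree l c ≤ 2
induced-degree≤2 i@([-]) (here refl) = ℕ.m≤n⇒m≤1+n (degree-first≤1 i)
induced-degree≤2 i@(cons _ _ _ _) (here refl) = ℕ.m≤n⇒m≤1+n (degree-first≤1 i)
induced-degree≤2 {c = c} (cons {x} {d} {l} _ _ only i) (there (here refl)) =
  ℕ.≤-trans (filter-∷-≤ (adjacent? c) x (d ∷ l)) (s≤s (degree-first≤1 i))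
induced-degree≤2 {c = c} (cons {x} _ _ only i) (there (there c∈)) = ℕ.≤-trans
  (ℕ.≤-reflexive (cong length (filter-reject (adjacent? c) {x} λ c~x → notHead i c∈ (only (there c∈) (adjacent-sym {c} {x} c~x)))))
  (induced-degree≤2 i (there c∈))
  where
  notHead : ∀ {d l} → Induced (d ∷ l) → c ∈ l → c ≢ d
  notHead i c∈ refl with d∉ ∷ _ ← induced-unique i = All.lookup d∉ c∈ refl

adjacentIn-sym : ∀ {S c d} → AdjacentIn S c d → AdjacentIn S d c
adjacentIn-sym {c = c} {d} (c∈ , d∈ , c~d) = d∈ , c∈ , adjacent-sym {c} {d} c~d

induced-reach : ∀ {S c l d} → (∀ {e} → e ∈ c ∷ l → e ∈ S) → Induced (c ∷ l) → d ∈ c ∷ l → Star (AdjacentIn S) c d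
induced-reach ⊆S i                (here refl) = ε
induced-reach ⊆S (cons c~d _ _ i) (there d∈)  =
  (⊆S (here refl) , ⊆S (there (here refl)) , c~d) ◅ induced-reach (⊆S ∘ there) i d∈

induced-connected : ∀ {l c d} → Induced l → c ∈ l → d ∈ l → Star (AdjacentIn l) c d
induced-connected {_ ∷ _} i c∈ d∈ =
  Star.reverse adjacentIn-sym (induced-reach (λ e∈ → e∈) i c∈) ◅◅ induced-reach (λ e∈ → e∈) i d∈

last-adjacent : ∀ {e} a l → Linked Adjacent (a ∷ l ∷ʳ e) → ∃[ z ] z ∈ a ∷ l × Adjacent z e
last-adjacent a []      (a~e ∷ _) = a , here refl , a~e
last-adjacent a (b ∷ l) (_ ∷ lnk) with z , z∈ , z~e ← last-adjacent b l lnk = z , there z∈ , z~e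

record TwoNeighbours (S : List Cell) (x : Cell) : Set where
  constructor neighbours
  field
    {y z} : Cell
    y∈    : y ∈ S
    z∈    : z ∈ S
    x~y   : Adjacent x y
    x~z   : Adjacent x z
    y≢z   : y ≢ z

interior-twoNeighbours : ∀ {S x e} p l → Linked Adjacent (p ∷ l ∷ʳ e) → Unique (p ∷ l) →
  All (_∈ S) (p ∷ l) → e ∈ S → p ≢ e → All (_≢ e) l → x ∈ l → TwoNeighbours S x
interior-twoNeighbours p (a ∷ []) (p~a ∷ a~e ∷ _) _ (p∈ ∷ _) e∈ p≢e _ (here refl) =
  neighbours p∈ e∈ (adjacent-sym {p} {a} p~a) a~e p≢e
interior-twoNeighbours p (a ∷ b ∷ l) (p~a ∷ a~b ∷ _) ((_ ∷ p≢b ∷ _) ∷ _) (p∈ ∷ _ ∷ b∈ ∷ _) _ _ _ (here refl) =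
  neighbours p∈ b∈ (adjacent-sym {p} {a} p~a) a~b p≢b
interior-twoNeighbours p (a ∷ l) (_ ∷ lnk) (_ ∷ u) (_ ∷ l∈) e∈ _ (a≢e ∷ l≢e) (there x∈) =
  interior-twoNeighbours a l lnk u l∈ e∈ a≢e l≢e x∈

cycle-twoNeighbours : ∀ {S c cs x} → IsCycle S c cs → x ∈ c ∷ cs → TwoNeighbours S x
cycle-twoNeighbours {cs = []}    cyc _ with s≤s () ← IsCycle.long cyc
cycle-twoNeighbours {cs = _ ∷ []} cyc _ with s≤s (s≤s ()) ← IsCycle.long cyc
cycle-twoNeighbours {c = c} {cs = d ∷ d′ ∷ l} cyc x∈
  with c∈ ∷ d∈ ∷ l∈ ← IsCycle.inside cyc
     | (c≢d ∷ c≢l) ∷ (d≢l ∷ u) ← IsCycle.distinct cyc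
     | c~d ∷ d~d′ ∷ lnk ← IsCycle.closed cyc
     | x∈
... | here refl with z , z∈ , z~c ← last-adjacent d′ l lnk =
  neighbours d∈ (All.lookup l∈ z∈) c~d (adjacent-sym {z} {c} z~c) (All.lookup d≢l z∈)
... | there (here refl) =
  neighbours c∈ (All.lookup l∈ (here refl)) (adjacent-sym {c} {d} c~d) d~d′ (λ { refl → All.lookup c≢l (here refl) refl })
... | there (there x∈l) =
  interior-twoNeighbours d (d′ ∷ l) (d~d′ ∷ lnk) (d≢l ∷ u) (d∈ ∷ l∈) c∈ (c≢d ∘ sym) (All.map (_∘ sym) c≢l) x∈l

induced-acyclic : ∀ {l c cs} → Induced l → ¬ IsCycle l c cs
induced-acyclic {c ∷ []} [-] cyc
  with neighbours (here refl) _ x~y _ _ ← cycle-twoNeighbours cyc (here refl)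
     | here refl ∷ _ ← IsCycle.inside cyc = adjacent-irrefl {c} x~y
induced-acyclic {x ∷ d ∷ l} {c} {cs} (cons _ _ only i) cyc with x ∈? (c ∷ cs)
... | yes x∈ with neighbours y∈ z∈ x~y x~z y≢z ← cycle-twoNeighbours cyc x∈ =
  y≢z (trans (only (later y∈ x~y) x~y) (sym (only (later z∈ x~z) x~z)))
  where
  later : ∀ {y} → y ∈ x ∷ d ∷ l → Adjacent x y → y ∈ d ∷ l
  later (here refl) x~x = contradiction x~x (adjacent-irrefl {x})
  later (there y∈)  _   = y∈
... | no x∉ = induced-acyclic i record
  { inside   = All.tabulate λ e∈ → later e∈ (All.lookup (IsCycle.inside cyc) e∈)
  ; distinct = IsCycle.distinct cyc
  ; long     = IsCycle.long cyc
  ; closed   = IsCycle.closed cyc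
  }
  where
  later : ∀ {e} → e ∈ c ∷ cs → e ∈ x ∷ d ∷ l → e ∈ d ∷ l
  later e∈ (here refl) = contradiction e∈ x∉
  later e∈ (there e∈l) = e∈l

induced-snake : ∀ {l} → Induced l → IsSnake (length l) l
induced-snake i = record
  { unique    = induced-unique i
  ; size      = refl
  ; connected = induced-connected i
  ; acyclic   = λ _ _ → induced-acyclic i
  ; degree≤2  = induced-degree≤2 i
  }

module _ {A : Set} {R : A → A → Set} where

  allPairs-++⁻ˡ : ∀ xs {ys} → AllPairs R (xs ++ ys) → AllPairs R xs
  allPairs-++⁻ˡ []       _        = []
  allPairs-++⁻ˡ (x ∷ xs) (r ∷ rs) = All.++⁻ˡ xs r ∷ allPairs-++⁻ˡ xs rs

  linked-++⁻ˡ : ∀ xs {ys} → Linked R (xs ++ ys) → Linked R xs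
  linked-++⁻ˡ []           _        = []
  linked-++⁻ˡ (x ∷ [])     _        = [-]
  linked-++⁻ˡ (x ∷ y ∷ xs) (r ∷ rs) = r ∷ linked-++⁻ˡ (y ∷ xs) rs

  linked-∷ʳ : ∀ xs {y z} → Linked R (xs ∷ʳ y) → R y z → Linked R (xs ∷ʳ y ∷ʳ z)
  linked-∷ʳ []            _        r = r ∷ [-]
  linked-∷ʳ (x ∷ [])      (p ∷ ps) r = p ∷ r ∷ [-]
  linked-∷ʳ (x ∷ x′ ∷ xs) (p ∷ ps) r = p ∷ linked-∷ʳ (x′ ∷ xs) ps r

-- A second neighbour e of c further along the path would close a cycle.
path-induced : ∀ {S} c l → (∀ c cs → ¬ IsCycle S c cs) → All (_∈ S) (c ∷ l) → Unique (c ∷ l) →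
  Linked Adjacent (c ∷ l) → Induced (c ∷ l)
path-induced c []      acyc inS u lnk = [-]
path-induced {S} c (d ∷ l) acyc inS@(_ ∷ l∈) u@(c∉ ∷ ul) lnk@(c~d ∷ ll) =
  cons c~d c∉ only (path-induced d l acyc l∈ ul ll)
  where
  only : ∀ {e} → e ∈ d ∷ l → Adjacent c e → e ≡ d
  only (here refl) _   = refl
  only {e} (there e∈)  c~e with ys , zs , refl ← ∈-∃++ e∈ = ⊥-elim (acyc c (d ∷ ys ∷ʳ e) record
    { inside   = All.++⁻ˡ path (subst (All (_∈ S)) split inS)
    ; distinct = allPairs-++⁻ˡ path (subst Unique split u)
    ; long     = s≤s (s≤s (nonempty ys))
    ; closed   = linked-∷ʳ (c ∷ d ∷ ys) (linked-++⁻ˡ path (subst (Linked Adjacent) split lnk)) (adjacent-sym {c} {e} c~e)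
    })
    where
    path : List Cell
    path = c ∷ d ∷ ys ∷ʳ e
    split : c ∷ d ∷ ys ++ [ e ] ++ zs ≡ path ++ zs
    split = cong (λ k → c ∷ d ∷ k) (sym (++-assoc ys [ e ] zs))
    nonempty : ∀ ys → 1 ≤ length (ys ∷ʳ e)
    nonempty []      = s≤s z≤n
    nonempty (_ ∷ _) = s≤s z≤n

-- Walks

data Walk : State → ℕ → ℕ → Set
data Via : Maybe State → ℕ → ℕ → Set

data Walk where
  done : ∀ {s} → Walk s 0 0
  step : ∀ {s h n} δ → Via (next s δ) (move δ h) n → Walk s (suc h) (suc n)

data Via where
  pass : ∀ {s h n} → Walk s h n → Via (just s) h n

walk↔fin : ∀ s h n → Walk s h n ↔ Fin (count s h n)
via↔fin  : ∀ m h n → Via m h n ↔ Fin (countVia m h n)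

walk↔fin s zero    zero    = ↔-trans (mk↔ₛ′ (λ _ → tt) (λ _ → done) (λ _ → refl) λ { done → refl }) (↔-sym 1↔⊤)
walk↔fin s zero    (suc n) = ↔-trans (mk↔ₛ′ (λ ()) (λ ()) (λ ()) λ ()) (↔-sym 0↔⊥)
walk↔fin s (suc h) zero    = ↔-trans (mk↔ₛ′ (λ ()) (λ ()) (λ ()) λ ()) (↔-sym 0↔⊥)
walk↔fin s (suc h) (suc n) = ↔-trans firstStep
  (↔-trans ((via↔fin (next s north) (suc h) n ⊎-↔ via↔fin (next s east) (suc (suc h)) n) ⊎-↔ via↔fin (next s west) h n)
  (↔-trans (↔-sym +↔⊎ ⊎-↔ ↔-refl) (↔-sym +↔⊎)))
  where
  firstStep : Walk s (suc h) (suc n) ↔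
    ((Via (next s north) (suc h) n ⊎ Via (next s east) (suc (suc h)) n) ⊎ Via (next s west) h n)
  firstStep = mk↔ₛ′
    (λ { (step north v) → inj₁ (inj₁ v) ; (step east v) → inj₁ (inj₂ v) ; (step west v) → inj₂ v })
    (λ { (inj₁ (inj₁ v)) → step north v ; (inj₁ (inj₂ v)) → step east v ; (inj₂ v) → step west v })
    (λ { (inj₁ (inj₁ v)) → refl ; (inj₁ (inj₂ v)) → refl ; (inj₂ v) → refl })
    (λ { (step north v) → refl ; (step east v) → refl ; (step west v) → refl })

via↔fin nothing  h n = ↔-trans (mk↔ₛ′ (λ ()) (λ ()) (λ ()) λ ()) (↔-sym 0↔⊥)
via↔fin (just s) h n = ↔-trans (mk↔ₛ′ (λ { (pass w) → w }) pass (λ _ → refl) λ { (pass _) → refl }) (walk↔fin s h n)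

cells    : ∀ {s h n} → Cell → Walk s h n → List Cell
cellsVia : ∀ {m h n} → Cell → Via m h n → List Cell
cells c done       = c ∷ []
cells c (step δ v) = c ∷ cellsVia (vector δ ⊞ c) v
cellsVia c (pass w) = cells c w

length-cells    : ∀ {s h n} c (w : Walk s h n) → length (cells c w) ≡ suc n
length-cellsVia : ∀ {m h n} c (v : Via m h n) → length (cellsVia c v) ≡ suc n
length-cells c done        = refl
length-cells c (step δ v)  = cong suc (length-cellsVia (vector δ ⊞ c) v)
length-cellsVia c (pass w) = length-cells c w

cells-∷ : ∀ {s h n} c (w : Walk s h n) → ∃[ l ] cells c w ≡ c ∷ l
cells-∷ c done       = [] , refl
cells-∷ c (step δ v) = cellsVia (vector δ ⊞ c) v , refl

cellsVia-∷ : ∀ {m h n} c (v : Via m h n) → ∃[ l ] cellsVia c v ≡ c ∷ l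
cellsVia-∷ c (pass w) = cells-∷ c w

firstVia∈ : ∀ {m h n c} (v : Via m h n) → c ∈ cellsVia c v
firstVia∈ {c = c} v with l , eq ← cellsVia-∷ c v = subst (c ∈_) (sym eq) (here refl)

⊞-comm₃ : ∀ u v c → u ⊞ v ⊞ c ≡ v ⊞ u ⊞ c
⊞-comm₃ (a , b) (a′ , b′) (x , y) = cong₂ _,_ (comm a a′ x) (comm b b′ y)
  where
  open +-*-Solver
  comm : ∀ i j k → i ℤ.+ (j ℤ.+ k) ≡ j ℤ.+ (i ℤ.+ k)
  comm = solve 3 (λ i j k → i :+ (j :+ k) := j :+ (i :+ k)) refl

⊞-assoc : ∀ u v c → u ⊞ v ⊞ c ≡ (u ⊞ v) ⊞ c
⊞-assoc (a , b) (a′ , b′) (x , y) = cong₂ _,_ (sym (ℤ.+-assoc a a′ x)) (sym (ℤ.+-assoc b b′ y))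

⊞-cancelʳ : ∀ {u v} c → u ⊞ c ≡ v ⊞ c → u ≡ v
⊞-cancelʳ {a , b} {a′ , b′} (x , y) eq =
  cong₂ _,_ (∙-cancelʳ x a a′ (cong proj₁ eq)) (∙-cancelʳ y b b′ (cong proj₂ eq))

map-cells    : ∀ {s h n} u c (w : Walk s h n) → map (u ⊞_) (cells c w) ≡ cells (u ⊞ c) w
map-cellsVia : ∀ {m h n} u c (v : Via m h n) → map (u ⊞_) (cellsVia c v) ≡ cellsVia (u ⊞ c) v
map-cells u c done       = refl
map-cells u c (step δ v) = cong (u ⊞ c ∷_) (trans (map-cellsVia u (vector δ ⊞ c) v)
  (cong (λ d → cellsVia d v) (⊞-comm₃ u (vector δ) c)))
map-cellsVia u c (pass w) = map-cells u c w

norm : Cell → ℕ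
norm (a , b) = ℤ.∣ a ∣ ℕ.+ ℤ.∣ b ∣

distance-⊞ : ∀ u c → distance c (u ⊞ c) ≡ norm u
distance-⊞ (a , b) (x , y) = cong₂ ℕ._+_ (difference x a) (difference y b)
  where
  open +-*-Solver
  difference : ∀ i j → ℤ.∣ i ℤ.- (j ℤ.+ i) ∣ ≡ ℤ.∣ j ∣
  difference i j = trans (cong ℤ.∣_∣ (solve 2 (λ i j → i :- (j :+ i) := :- j) refl i j)) (ℤ.∣-i∣≡∣i∣ j)

vector-injective : ∀ δ δ′ → vector δ ≡ vector δ′ → δ ≡ δ′
vector-injective north north _ = refl
vector-injective east  east  _ = refl
vector-injective west  west  _ = refl

step-adjacent : ∀ {c d} → Step c d → Adjacent c d
step-adjacent {c} (δ , refl) = trans (distance-⊞ (vector δ) c) (unit δ)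
  where
  unit : ∀ δ → norm (vector δ) ≡ 1
  unit north = refl
  unit east  = refl
  unit west  = refl

-- (a , k) is the displacement from the current cell to a later one.
Reach : State → ℤ → ℕ → Set
Reach E  a k = + 0 ℤ.≤ a ⊎ 2 ≤ k
Reach EN a k = + 0 ℤ.≤ a ⊎ 1 ≤ k
Reach NN a k = ⊤
Reach WN a k = a ℤ.≤ + 0 ⊎ 1 ≤ k
Reach W  a k = a ℤ.≤ + 0 ⊎ 2 ≤ k

record Displaced (m : Maybe State) (c e : Cell) : Set where
  constructor displaced
  field
    {s} : State
    is  : m ≡ just s
    a   : ℤ
    k   : ℕ
    e≡  : e ≡ (a , + k) ⊞ c
    bound : Reach s a k

reach-zero : ∀ s → Reach s (+ 0) 0
reach-zero E  = inj₁ ℤ.≤-refl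
reach-zero EN = inj₁ ℤ.≤-refl
reach-zero NN = tt
reach-zero WN = inj₁ ℤ.≤-refl
reach-zero W  = inj₁ ℤ.≤-refl

rise : Direction → ℕ → ℕ
rise north k = suc k
rise east  k = k
rise west  k = k

shift : ∀ δ a k c → (a , + k) ⊞ vector δ ⊞ c ≡ (proj₁ (vector δ) ℤ.+ a , + rise δ k) ⊞ c
shift δ a k c = trans (⊞-comm₃ (a , + k) (vector δ) c) (trans (⊞-assoc (vector δ) (a , + k) c)
  (cong (λ j → (proj₁ (vector δ) ℤ.+ a , j) ⊞ c) (lemma δ)))
  where
  lemma : ∀ δ → proj₂ (vector δ) ℤ.+ + k ≡ + rise δ k
  lemma north = refl
  lemma east  = refl
  lemma west  = refl

0≤1+ : ∀ {a} → + 0 ℤ.≤ a → + 0 ℤ.≤ + 1 ℤ.+ a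
0≤1+ {+ _} _ = ℤ.+≤+ z≤n

-1+≤0 : ∀ {a} → a ℤ.≤ + 0 → -[1+ 0 ] ℤ.+ a ℤ.≤ + 0
-1+≤0 a≤0 = ℤ.+-mono-≤ {x = -[1+ 0 ]} {y = + 0} ℤ.-≤+ a≤0

reach-step : ∀ s δ {s′ a k} → next s δ ≡ just s′ → Reach s′ a k → Reach s (proj₁ (vector δ) ℤ.+ a) (rise δ k)
reach-step E  north {a = a} refl (inj₁ p) = inj₁ (subst (+ 0 ℤ.≤_) (sym (ℤ.+-identityˡ a)) p)
reach-step E  north refl (inj₂ p) = inj₂ (s≤s p)
reach-step E  east  refl (inj₁ p) = inj₁ (0≤1+ p)
reach-step E  east  refl (inj₂ p) = inj₂ p
reach-step EN north refl _        = inj₂ (s≤s z≤n)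
reach-step EN east  refl (inj₁ p) = inj₁ (0≤1+ p)
reach-step EN east  refl (inj₂ p) = inj₂ (ℕ.<⇒≤ p)
reach-step NN δ     _    _        = tt
reach-step WN north refl _        = inj₂ (s≤s z≤n)
reach-step WN west  refl (inj₁ p) = inj₁ (-1+≤0 p)
reach-step WN west  refl (inj₂ p) = inj₂ (ℕ.<⇒≤ p)
reach-step W  north {a = a} refl (inj₁ p) = inj₁ (subst (ℤ._≤ + 0) (sym (ℤ.+-identityˡ a)) p)
reach-step W  north refl (inj₂ p) = inj₂ (s≤s p)
reach-step W  west  refl (inj₁ p) = inj₁ (-1+≤0 p)
reach-step W  west  refl (inj₂ p) = inj₂ p

zero-displaced : ∀ {s c} → Displaced (just s) c c
zero-displaced {s} {x , y} = displaced refl (+ 0) 0 (sym (cong₂ _,_ (ℤ.+-identityˡ x) (ℤ.+-identityˡ y))) (reach-zero s)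

cells-displaced    : ∀ {s h n c e} (w : Walk s h n) → e ∈ cells c w → Displaced (just s) c e
cellsVia-displaced : ∀ {m h n c e} (v : Via m h n) → e ∈ cellsVia c v → Displaced m c e
cells-displaced done       (here refl) = zero-displaced
cells-displaced (step δ v) (here refl) = zero-displaced
cells-displaced {s} {c = c} (step δ v) (there e∈) with displaced eq a k e≡ b ← cellsVia-displaced v e∈ =
  displaced refl (proj₁ (vector δ) ℤ.+ a) (rise δ k) (trans e≡ (shift δ a k c)) (reach-step s δ eq b)
cellsVia-displaced (pass w) e∈ = cells-displaced w e∈

Beyond : Direction → Cell → Set
Beyond δ u = norm u ≢ 0 × (norm u ≡ 1 → u ≡ vector δ)

tooHigh : ∀ {δ a k} → 2 ≤ k → Beyond δ (a , + k)
tooHigh {a = a} {k} 2≤k = (λ eq → contradiction (subst (2 ≤_) eq 2≤) λ ()) , (λ eq → contradiction (subst (2 ≤_) eq 2≤) λ { (s≤s ()) })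
  where
  2≤ : 2 ≤ ℤ.∣ a ∣ ℕ.+ k
  2≤ = ℕ.≤-trans 2≤k (ℕ.m≤n+m k ℤ.∣ a ∣)

shifted-beyond : ∀ s δ {s′ a k} → next s δ ≡ just s′ → Reach s′ a k →
  Beyond δ (proj₁ (vector δ) ℤ.+ a , + rise δ k)
shifted-beyond s north {a = a} {k} _ _ = nonzero , unit
  where
  nonzero : ℤ.∣ + 0 ℤ.+ a ∣ ℕ.+ suc k ≢ 0
  nonzero eq with () ← trans (sym (ℕ.+-suc ℤ.∣ + 0 ℤ.+ a ∣ k)) eq
  unit : ℤ.∣ + 0 ℤ.+ a ∣ ℕ.+ suc k ≡ 1 → (+ 0 ℤ.+ a , + suc k) ≡ (+ 0 , + 1)
  unit eq with sum≡0 ← ℕ.suc-injective (trans (sym (ℕ.+-suc ℤ.∣ + 0 ℤ.+ a ∣ k)) eq) =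
    cong₂ (λ i j → i , + suc j) (ℤ.∣i∣≡0⇒i≡0 (ℕ.m+n≡0⇒m≡0 _ sum≡0)) (ℕ.m+n≡0⇒n≡0 ℤ.∣ + 0 ℤ.+ a ∣ sum≡0)
shifted-beyond s east {s′} {a} {k} eq b = beyond (subst (λ t → Reach t a k) (nextEast s eq) b)
  where
  nextEast : ∀ s → next s east ≡ just s′ → s′ ≡ E
  nextEast E  refl = refl
  nextEast EN refl = refl
  nextEast NN refl = refl
  beyond : ∀ {a k} → Reach E a k → Beyond east (+ 1 ℤ.+ a , + k)
  beyond {+ j}      {k} _ = (λ ()) , λ eq → cong₂ (λ i l → + suc i , + l)
    (ℕ.m+n≡0⇒m≡0 j (ℕ.suc-injective eq)) (ℕ.m+n≡0⇒n≡0 j (ℕ.suc-injective eq))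
  beyond { -[1+ j ]} (inj₂ 2≤k) = tooHigh {east} 2≤k
shifted-beyond s west {s′} {a} {k} eq b = beyond (subst (λ t → Reach t a k) (nextWest s eq) b)
  where
  nextWest : ∀ s → next s west ≡ just s′ → s′ ≡ W
  nextWest W  refl = refl
  nextWest WN refl = refl
  nextWest NN refl = refl
  beyond : ∀ {a k} → Reach W a k → Beyond west (-[1+ 0 ] ℤ.+ a , + k)
  beyond { -[1+ j ]} {k} _ = (λ ()) , λ ()
  beyond {+ 0}       {k} _ = (λ ()) , λ eq → cong (λ l → -[1+ 0 ] , + l) (ℕ.suc-injective eq)
  beyond {+ suc j}   (inj₁ (ℤ.+≤+ ()))
  beyond {+ suc j}   (inj₂ 2≤k) = tooHigh {west} 2≤k

displaced-apart : ∀ s δ c {e} → Displaced (next s δ) (vector δ ⊞ c) e →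
  c ≢ e × (Adjacent c e → e ≡ vector δ ⊞ c)
displaced-apart s δ c (displaced is a k refl b)
  with nonzero , unit ← shifted-beyond s δ is b =
  subst (λ e → c ≢ e × (Adjacent c e → e ≡ vector δ ⊞ c)) (sym (shift δ a k c))
    ( (λ c≡ → nonzero (trans (sym (distance-⊞ u c)) (trans (cong (distance c) (sym c≡)) (distance-refl c))))
    , (λ c~ → cong (_⊞ c) (unit (trans (sym (distance-⊞ u c)) c~))))
  where
  u : Cell
  u = proj₁ (vector δ) ℤ.+ a , + rise δ k

step-injective : ∀ {δ δ′} c → vector δ ⊞ c ≡ vector δ′ ⊞ c → δ ≡ δ′
step-injective c eq = vector-injective _ _ (⊞-cancelʳ c eq)

cells-induced    : ∀ {s h n} c (w : Walk s h n) → Induced (cells c w)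
cellsVia-induced : ∀ {m h n} c (v : Via m h n) → Induced (cellsVia c v)
step-induced     : ∀ {h n} s δ c (v : Via (next s δ) h n) → Induced (c ∷ cellsVia (vector δ ⊞ c) v)
cells-induced     c done       = [-]
cells-induced {s} c (step δ v) = step-induced s δ c v
cellsVia-induced  c (pass w)   = cells-induced c w
step-induced s δ c v with cellsVia (vector δ ⊞ c) v | cellsVia-∷ (vector δ ⊞ c) v | cellsVia-induced (vector δ ⊞ c) v
   | (λ {e} → cellsVia-displaced {c = vector δ ⊞ c} {e = e} v)
... | _ | l , refl | i | disp = cons (step-adjacent {c} (δ , refl))
  (All.tabulate λ e∈ → proj₁ (displaced-apart s δ c (disp e∈))) (λ e∈ → proj₂ (displaced-apart s δ c (disp e∈))) i

cells-unique    : ∀ {s h n} c (w w′ : Walk s h n) → cells c w ↭ cells c w′ → w ≡ w′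
cellsVia-unique : ∀ {m h n} c (v v′ : Via m h n) → cellsVia c v ↭ cellsVia c v′ → v ≡ v′
cells-unique c done done _ = refl
cells-unique {s} c (step δ v) (step δ′ v′) p
  with refl ← step-injective {δ} {δ′} c (proj₂ (displaced-apart s δ′ c
         (cellsVia-displaced v′ (∈-resp-↭ (drop-∷ p) (firstVia∈ v)))) (step-adjacent {c} (δ , refl))) =
  cong (step δ) (cellsVia-unique (vector δ ⊞ c) v v′ (drop-∷ p))
cellsVia-unique c (pass w) (pass w′) p = cong pass (cells-unique c w w′ p)

cells-steps    : ∀ {s h n} c (w : Walk s h n) → Linked Step (cells c w)
cellsVia-steps : ∀ {m h n} c (v : Via m h n) → Linked Step (cellsVia c v)
step-steps     : ∀ {m h n} δ c (v : Via m h n) → Linked Step (c ∷ cellsVia (vector δ ⊞ c) v)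
cells-steps c done       = [-]
cells-steps c (step δ v) = step-steps δ c v
cellsVia-steps c (pass w) = cells-steps c w
step-steps δ c v with cellsVia (vector δ ⊞ c) v | cellsVia-∷ (vector δ ⊞ c) v | cellsVia-steps (vector δ ⊞ c) v
... | _ | l , refl | steps = (δ , refl) ∷ steps

-- Columns

column-⊞ : ∀ t u c → column t (u ⊞ c) ≡ proj₁ u ℤ.+ column t c
column-⊞ (x₀ , _) (a , _) (x , _) =
  solve 3 (λ x₀ a x → a :+ x :- x₀ :+ con (+ 1) := a :+ (x :- x₀ :+ con (+ 1))) refl x₀ a x
  where open +-*-Solver

column-self : ∀ t → column t t ≡ + 1
column-self (x₀ , _) = cong (ℤ._+ + 1) (ℤ.i≡j⇒i-j≡0 {x₀} refl)

column-move : ∀ t δ c {h} → column t c ≡ + suc (suc h) → column t (vector δ ⊞ c) ≡ + suc (move δ h)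
column-move t δ c {h} eq = trans (column-⊞ t (vector δ) c) (trans (cong (λ i → proj₁ (vector δ) ℤ.+ i) eq) (lemma δ))
  where
  lemma : ∀ δ → proj₁ (vector δ) ℤ.+ + suc (suc h) ≡ + suc (move δ h)
  lemma north = refl
  lemma east  = refl
  lemma west  = refl

move≡0 : ∀ δ {h} → move δ h ≡ 0 → δ ≡ west × h ≡ 0
move≡0 west refl = refl , refl

record Descends (t : Cell) (cs : List Cell) : Set where
  constructor descends
  field
    {others} : List Cell
    {head}   : Cell
    cs≡      : cs ≡ others ∷ʳ head
    others≥2 : All (λ c → + 2 ℤ.≤ column t c) others
    head≡1   : column t head ≡ + 1

cells-descend    : ∀ {s h n} t c (w : Walk s h n) → column t c ≡ + suc h → Descends t (cells c w)
cellsVia-descend : ∀ {m h n} t c (v : Via m h n) → column t c ≡ + suc h → Descends t (cellsVia c v)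
cells-descend t c done       eq = descends {others = []} refl [] eq
cells-descend t c (step δ v) eq
  with descends {others} cs≡ ≥2 ≡1 ← cellsVia-descend t (vector δ ⊞ c) v (column-move t δ c eq) =
  descends {others = c ∷ others} (cong (c ∷_) cs≡) (subst (+ 2 ℤ.≤_) (sym eq) (ℤ.+≤+ (s≤s (s≤s z≤n))) ∷ ≥2) ≡1
cellsVia-descend t c (pass w) = cells-descend t c w

-- From induced paths to walks

Admits : State → Cell → List Cell → Set
Admits E  c l = ∀ {e} → e ∈ l → e ≢ vector west ⊞ c × e ≢ vector west ⊞ vector north ⊞ c
Admits EN c l = ∀ {e} → e ∈ l → e ≢ vector west ⊞ c
Admits NN c l = ⊤
Admits WN c l = ∀ {e} → e ∈ l → e ≢ vector east ⊞ c
Admits W  c l = ∀ {e} → e ∈ l → e ≢ vector east ⊞ c × e ≢ vector east ⊞ vector north ⊞ c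

AdmitsVia : Maybe State → Cell → List Cell → Set
AdmitsVia nothing  c l = ⊥
AdmitsVia (just s) c l = Admits s c l

⊞-inverse : ∀ u v c → u ⊞ v ≡ (+ 0 , + 0) → u ⊞ v ⊞ c ≡ c
⊞-inverse u v c eq = trans (⊞-assoc u v c) (trans (cong (_⊞ c) eq)
  (cong₂ _,_ (ℤ.+-identityˡ (proj₁ c)) (ℤ.+-identityˡ (proj₂ c))))

-- The cell north of c is adjacent to c, so it is not visited after a
-- horizontal step from c.
horizontal-admits : ∀ δ δ⁻ {c l} → vector δ⁻ ⊞ vector δ ≡ (+ 0 , + 0) → δ ≢ north →
  Induced (c ∷ vector δ ⊞ c ∷ l) →
  ∀ {e} → e ∈ l → e ≢ vector δ⁻ ⊞ vector δ ⊞ c × e ≢ vector δ⁻ ⊞ vector north ⊞ vector δ ⊞ c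
horizontal-admits δ δ⁻ {c} {l} inv δ≢north (cons _ c∉ only i) {e} e∈ = notBack , notBeside
  where
  notBack : e ≢ vector δ⁻ ⊞ vector δ ⊞ c
  notBack e≡ = All.lookup c∉ (there e∈) (sym (trans e≡ (⊞-inverse (vector δ⁻) (vector δ) c inv)))

  notBeside : e ≢ vector δ⁻ ⊞ vector north ⊞ vector δ ⊞ c
  notBeside e≡ = δ≢north (step-injective c (trans (sym (only (there e∈) c~e)) e≡north))
    where
    e≡north : e ≡ vector north ⊞ c
    e≡north = trans e≡ (trans (⊞-comm₃ (vector δ⁻) (vector north) (vector δ ⊞ c))
      (cong (vector north ⊞_) (⊞-inverse (vector δ⁻) (vector δ) c inv)))
    c~e : Adjacent c e
    c~e = subst (Adjacent c) (sym e≡north) (step-adjacent {c} (north , refl))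

east-admits : ∀ {c l} → Induced (c ∷ vector east ⊞ c ∷ l) → Admits E (vector east ⊞ c) l
east-admits = horizontal-admits east west refl λ ()

west-admits : ∀ {c l} → Induced (c ∷ vector west ⊞ c ∷ l) → Admits W (vector west ⊞ c) l
west-admits = horizontal-admits west east refl λ ()

admits-next : ∀ s δ {c l} → Admits s c (vector δ ⊞ c ∷ l) → Induced (c ∷ vector δ ⊞ c ∷ l) →
  AdmitsVia (next s δ) (vector δ ⊞ c) l
admits-next E  north a i = λ e∈ → proj₂ (a (there e∈))
admits-next E  east  a i = east-admits i
admits-next E  west  a i = proj₁ (a (here refl)) refl
admits-next EN north a i = tt
admits-next EN east  a i = east-admits i
admits-next EN west  a i = a (here refl) refl
admits-next NN north a i = tt
admits-next NN east  a i = east-admits i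
admits-next NN west  a i = west-admits i
admits-next WN north a i = tt
admits-next WN east  a i = a (here refl) refl
admits-next WN west  a i = west-admits i
admits-next W  north a i = λ e∈ → proj₂ (a (there e∈))
admits-next W  east  a i = proj₁ (a (here refl)) refl
admits-next W  west  a i = west-admits i

induced-tail : ∀ {c d l} → Induced (c ∷ d ∷ l) → Induced (d ∷ l)
induced-tail (cons _ _ _ i) = i

descendVia-done : ∀ m {c} → AdmitsVia m c [] → ∃[ v ] cellsVia {m} {0} {0} c v ≡ c ∷ []
descendVia-done (just s) _ = pass done , refl

module _ (t : Cell) {head : Cell} (head≡1 : column t head ≡ + 1) where

  descend : ∀ s h c others → column t c ≡ + suc (suc h) → Admits s c (others ∷ʳ head) →
    Induced (c ∷ others ∷ʳ head) → Linked Step (c ∷ others ∷ʳ head) → All (λ e → + 2 ℤ.≤ column t e) others →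
    ∃[ w ] cells {s} {suc h} {length (others ∷ʳ head)} c w ≡ c ∷ others ∷ʳ head
  descendVia : ∀ m h c others → column t c ≡ + suc (suc h) → AdmitsVia m c (others ∷ʳ head) →
    Induced (c ∷ others ∷ʳ head) → Linked Step (c ∷ others ∷ʳ head) → All (λ e → + 2 ℤ.≤ column t e) others →
    ∃[ v ] cellsVia {m} {suc h} {length (others ∷ʳ head)} c v ≡ c ∷ others ∷ʳ head

  descend s h c [] eq a i ((δ , refl) ∷ _) []
    with refl , refl ← move≡0 δ (ℕ.suc-injective (ℤ.+-injective (trans (sym (column-move t δ c eq)) head≡1)))
    with v , v≡ ← descendVia-done (next s west) (admits-next s west a i) = step west v , cong (c ∷_) v≡
  descend s h c (d ∷ others) eq a i ((north , refl) ∷ steps) (_ ∷ ≥2)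
    with v , v≡ ← descendVia (next s north) h d others (column-move t north c eq)
           (admits-next s north a i) (induced-tail i) steps ≥2 = step north v , cong (c ∷_) v≡
  descend s h c (d ∷ others) eq a i ((east , refl) ∷ steps) (_ ∷ ≥2)
    with v , v≡ ← descendVia (next s east) (suc h) d others (column-move t east c eq)
           (admits-next s east a i) (induced-tail i) steps ≥2 = step east v , cong (c ∷_) v≡
  descend s (suc h) c (d ∷ others) eq a i ((west , refl) ∷ steps) (_ ∷ ≥2)
    with v , v≡ ← descendVia (next s west) h d others (column-move t west c eq)
           (admits-next s west a i) (induced-tail i) steps ≥2 = step west v , cong (c ∷_) v≡
  descend s zero c (d ∷ others) eq a i ((west , refl) ∷ steps) (2≤ ∷ ≥2)
    with ℤ.+≤+ (s≤s ()) ← subst (+ 2 ℤ.≤_) (column-move t west c eq) 2≤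

  descendVia (just s) h c others eq a i steps ≥2 with w , w≡ ← descend s h c others eq a i steps ≥2 = pass w , w≡

-- Bubbles as walks

BubbleWalk : ℕ → Set
BubbleWalk (suc (suc n)) = Walk E 1 n
BubbleWalk _             = ⊥

bubbleWalk↔fin : ∀ n → BubbleWalk n ↔ Fin (β n)
bubbleWalk↔fin zero          = ↔-sym 0↔⊥
bubbleWalk↔fin (suc zero)    = ↔-sym 0↔⊥
bubbleWalk↔fin (suc (suc n)) = walk↔fin E 1 n

bubbleCells : ∀ n → Cell → BubbleWalk n → List Cell
bubbleCells (suc (suc n)) t w = t ∷ cells (vector east ⊞ t) w

length-bubbleCells : ∀ n t w → length (bubbleCells n t w) ≡ n
length-bubbleCells (suc (suc n)) t w = cong suc (length-cells (vector east ⊞ t) w)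

bubbleCells-induced : ∀ n t w → Induced (bubbleCells n t w)
bubbleCells-induced (suc (suc n)) t w = step-induced NN east t (pass w)

map-bubbleCells : ∀ n u t w → map (u ⊞_) (bubbleCells n t w) ≡ bubbleCells n (u ⊞ t) w
map-bubbleCells (suc (suc n)) u t w = cong (u ⊞ t ∷_) (trans (map-cells u (vector east ⊞ t) w)
  (cong (λ d → cells d w) (⊞-comm₃ u (vector east) t)))

column-east : ∀ t → column t (vector east ⊞ t) ≡ + 2
column-east t = trans (column-⊞ t (vector east) t) (cong (λ i → + 1 ℤ.+ i) (column-self t))

bubbleCells-isBubble : ∀ n t w → IsBubble n (bubbleCells n t w)
bubbleCells-isBubble n@(suc (suc _)) t w
  with descends {others} {head} cs≡ others≥2 head≡1 ← cells-descend t (vector east ⊞ t) w (column-east t) =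
  ℤ.∣ column t best ∣ , record
  { 2≤r         = ℤ.drop‿+≤+ (subst (ℤ._≤ + ℤ.∣ column t best ∣) (column-east t) (≤best later∈))
  ; pds         = record
    { snake   = subst (λ m → IsSnake m S) (length-bubbleCells n t w) (induced-snake (bubbleCells-induced n t w))
    ; listing = S , record { listsS = ↭-refl ; steps = steps }
    }
  ; tail        = t
  ; others      = others
  ; head        = head
  ; listing     = record
    { listsS = ↭-reflexive (cong (t ∷_) (sym cs≡))
    ; steps  = subst (λ l → Linked Step (t ∷ l)) cs≡ steps
    }
  ; headColumn  = head≡1
  ; otherColumn = All.tabulate λ c∈ → All.lookup others≥2 c∈ , ≤best (subst (_ ∈_) (sym cs≡) (∈-++⁺ˡ c∈))
  ; reachesr    = lose best∈ best≡
  }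
  where
  open Data.List.Extrema ℤ.≤-totalOrder using (argmax; argmax-sel; f[xs]≤f[argmax])

  S later : List Cell
  S     = bubbleCells n t w
  later = cells (vector east ⊞ t) w

  best : Cell
  best = argmax (column t) t later

  later∈ : vector east ⊞ t ∈ later
  later∈ = firstVia∈ (pass w)

  steps : Linked Step S
  steps = step-steps east t (pass w)

  best≡ : column t best ≡ + ℤ.∣ column t best ∣
  best≡ = sym (ℤ.0≤i⇒+∣i∣≡i (ℤ.≤-trans (ℤ.+≤+ z≤n) (subst (ℤ._≤ column t best) (column-east t)
    (All.lookup (f[xs]≤f[argmax] {f = column t} t later) later∈))))

  ≤best : ∀ {c} → c ∈ later → column t c ℤ.≤ + ℤ.∣ column t best ∣
  ≤best {c} c∈ = subst (column t c ℤ.≤_) best≡ (All.lookup (f[xs]≤f[argmax] {f = column t} t later) c∈)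

  best∈ : best ∈ S
  best∈ with argmax-sel (column t) t later
  ... | inj₁ eq = here eq
  ... | inj₂ b∈ = there b∈

1≤i+1⇒0≤i : ∀ {i} → + 1 ℤ.≤ i ℤ.+ + 1 → + 0 ℤ.≤ i
1≤i+1⇒0≤i {+ _}          _ = ℤ.+≤+ z≤n
1≤i+1⇒0≤i { -[1+ zero ]} (ℤ.+≤+ ())

1≤column : ∀ {t c} → + 1 ℤ.≤ column t c → proj₁ t ℤ.≤ proj₁ c
1≤column 1≤ = ℤ.0≤i-j⇒j≤i (1≤i+1⇒0≤i 1≤)

tail-southwest : ∀ n t w {c} → c ∈ bubbleCells n t w → proj₁ t ℤ.≤ proj₁ c × proj₂ t ℤ.≤ proj₂ c
tail-southwest (suc (suc n)) t w {c} c∈ = leftmost c∈ , lowest c∈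
  where
  d : Cell
  d = vector east ⊞ t

  leftmost : c ∈ t ∷ cells d w → proj₁ t ℤ.≤ proj₁ c
  leftmost (here refl) = ℤ.≤-refl
  leftmost (there c∈l) with descends cs≡ ≥2 head≡1 ← cells-descend t d w (column-east t) =
    1≤column {t} {c} (All.lookup (All.∷ʳ⁺ (All.map (ℤ.≤-trans (ℤ.+≤+ (s≤s z≤n))) ≥2) (ℤ.≤-reflexive (sym head≡1)))
      (subst (c ∈_) cs≡ c∈l))

  lowest : c ∈ t ∷ cells d w → proj₂ t ℤ.≤ proj₂ c
  lowest (here refl) = ℤ.≤-refl
  lowest (there c∈l) with displaced _ _ k refl _ ← cells-displaced w c∈l =
    subst (λ y → proj₂ t ℤ.≤ + k ℤ.+ y) (sym (ℤ.+-identityˡ (proj₂ t))) (ℤ.i≤j+i (proj₂ t) (+ k))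

tail∈ : ∀ n t w → t ∈ bubbleCells n t w
tail∈ (suc (suc n)) t w = here refl

bubbleCells-injective : ∀ n t t′ w w′ → bubbleCells n t w ↭ bubbleCells n t′ w′ → w ≡ w′
bubbleCells-injective n@(suc (suc _)) t t′ w w′ p
  with x≤ , y≤ ← tail-southwest n t w (∈-resp-↭ (↭-sym p) (tail∈ n t′ w′))
     | x≥ , y≥ ← tail-southwest n t′ w′ (∈-resp-↭ p (tail∈ n t w))
  with refl ← cong₂ _,_ (ℤ.≤-antisym x≤ x≥) (ℤ.≤-antisym y≤ y≥) =
  cells-unique (vector east ⊞ t) w w′ (drop-∷ p)

isBubble⇒walk : ∀ {n S} → IsBubble n S → ∃[ w ] ∃[ t ] bubbleCells n t w ↭ S
isBubble⇒walk {n} {S} (r , b) = walk others listing otherColumn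
  where
  open IsBubbleOfWidth b
  open IsSnake (IsPDS.snake pds)

  listing-induced : ∀ {l} → tail ∷ l ↭ S → Linked Step (tail ∷ l) → Induced (tail ∷ l)
  listing-induced p steps = path-induced tail _ acyclic (All.tabulate (∈-resp-↭ p))
    (Unique-resp-↭ (↭⇒↭ₛ (↭-sym p)) unique) (Linked.map step-adjacent steps)

  walk : ∀ others → IsListing S (tail ∷ others ∷ʳ head) →
    All (λ c → + 2 ℤ.≤ column tail c × column tail c ℤ.≤ + r) others → ∃[ w ] ∃[ t ] bubbleCells n t w ↭ S
  walk [] l _ with Any-resp-↭ (↭-sym (IsListing.listsS l)) reachesr
  ... | here c≡r = contradiction (subst (2 ≤_) (ℤ.+-injective (trans (sym c≡r) (column-self tail))) 2≤r) λ { (s≤s ()) }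
  ... | there (here c≡r) = contradiction (subst (2 ≤_) (ℤ.+-injective (trans (sym c≡r) headColumn)) 2≤r) λ { (s≤s ()) }
  walk (o ∷ os) record { listsS = p ; steps = (north , refl) ∷ _ } ((2≤ , _) ∷ _)
    with ℤ.+≤+ (s≤s ()) ← subst (+ 2 ℤ.≤_) (trans (column-⊞ tail (vector north) tail) (cong (λ i → + 0 ℤ.+ i) (column-self tail))) 2≤
  walk (o ∷ os) record { listsS = p ; steps = (west , refl) ∷ _ } ((2≤ , _) ∷ _)
    with ℤ.+≤+ () ← subst (+ 2 ℤ.≤_) (trans (column-⊞ tail (vector west) tail) (cong (λ i → -[1+ 0 ] ℤ.+ i) (column-self tail))) 2≤
  walk (o ∷ os) record { listsS = p ; steps = stp@((east , refl) ∷ _) } (_ ∷ ≥2)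
    with i ← listing-induced p stp
    with w , w≡ ← descend tail headColumn E 0 o os (column-east tail) (east-admits i) (induced-tail i)
           (Linked.tail stp) (All.map proj₁ ≥2) =
    subst (λ m → ∃[ w ] ∃[ t ] bubbleCells m t w ↭ S) (trans (↭-length p) size)
      (w , tail , subst (λ l → tail ∷ l ↭ S) (sym w≡) p)

bubble↔walk : ∀ n → Inverse (Bubble n) (≡.setoid (BubbleWalk n))
bubble↔walk n = record
  { to        = λ (_ , b) → proj₁ (isBubble⇒walk b)
  ; from      = λ w → bubbleCells n origin w , bubbleCells-isBubble n origin w
  ; to-cong   = λ {(_ , b)} {(_ , b′)} S≈T → walk-unique (isBubble⇒walk b) (isBubble⇒walk b′) S≈T
  ; from-cong = λ { refl → ≈ᵗ-refl }
  ; inverse   = (λ {w} {(_ , b)} S≈ → walk-unique (isBubble⇒walk b) (w , origin , ↭-refl) S≈)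
              , λ { {(_ , b)} refl → from-to (isBubble⇒walk b) }
  }
  where
  origin : Cell
  origin = + 0 , + 0

  walk-unique : ∀ {S T} (x : ∃[ w ] ∃[ t ] bubbleCells n t w ↭ S) (y : ∃[ w ] ∃[ t ] bubbleCells n t w ↭ T) →
    S ≈ᵗ T → proj₁ x ≡ proj₁ y
  walk-unique (w , t , p) (w′ , t′ , p′) (u , S≈T) = bubbleCells-injective n (u ⊞ t) t′ w w′
    (↭-trans (↭-reflexive (sym (map-bubbleCells n u t w))) (↭-trans (map⁺ (u ⊞_) p) (↭-trans S≈T (↭-sym p′))))

  from-to : ∀ {S} (x : ∃[ w ] ∃[ t ] bubbleCells n t w ↭ S) → bubbleCells n origin (proj₁ x) ≈ᵗ S
  from-to (w , t , p) = t , ↭-trans (↭-reflexive (trans (map-bubbleCells n t origin w)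
    (cong (λ t → bubbleCells n t w) (cong₂ _,_ (ℤ.+-identityʳ (proj₁ t)) (ℤ.+-identityʳ (proj₂ t)))))) p

bubble-cardinality : ∀ n → HasCardinality (Bubble n) (β n)
bubble-cardinality n = Composition.inverse (bubble↔walk n) (bubbleWalk↔fin n)

mainTheorem4 : Σ (ℕ → ℕ) λ β → (∀ n → HasCardinality (Bubble n) (β n)) ×
    Σ Series λ √radicand → IsSqrt radicand √radicand ×
    IsQuotient (𝟏 - q - q ^ 2 - q ^ 3 - q ^ 4 - q ^ 5 - √radicand) (2 · q) (generatingFunction β)
mainTheorem4 = β , bubble-cardinality , √radicandSeries , √radicandSeries-sqrt , √radicandSeries-quotient
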